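{- Let $G$ be a finite connected cactus that is not isomorphic to $K_2$. Then the $2$-multigraph ${}^2G$ is locally irregular colorable and satisfies ${\rm lir}({}^2G)\leq 2$; that is, the edges of ${}^2G$ can be colored with at most two colors so that each color induces a locally irregular submultigraph.
   Context: All graphs are finite; $G$ is a simple graph. A cactus is a graph in which no two cycles intersect in more than one vertex (a graph without cycles is allowed). The $2$-multigraph ${}^2G$ is the multigraph obtained from $G$ by doubling each edge, i.e. every edge $uv$ of $G$ is replaced by two parallel single edges, which together form the multiedge $uv$. The degree $\hat d(v)$ of a vertex in a multigraph is the number of single edges incident with $v$. A multigraph is locally irregular if, for every multiedge (every pair of adjacent vertices), the degrees of its two end-vertices are distinct. A locally irregular coloring of a multigraph $M$ is a coloring of its single edges (the two parallel edges of a multiedge may receive the same or different colors; the coloring need not be proper) such that for every color the submultigraph formed by the edges of that color is locally irregular, i.e. whenever at least one single edge joining $u$ and $v$ has color $c$, the numbers of single edges of color $c$ incident with $u$ and with $v$ are different. A multigraph is locally irregular colorable if it admits a locally irregular coloring, and then ${\rm lir}(M)$ denotes the smallest number of colors in such a coloring. -}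

module Defs where

open import Algebra.Properties.CommutativeMonoid.Sum using (sum)
open import Data.Bool.Base using (Bool; false; T; if_then_else_; not)
open import Data.Fin.Base using (Fin; cast)
open import Data.Fin.Properties using (_≟_; cast-is-id)
open import Data.List.Base using (List; _∷_; [_]; _++_; length; zip)
open import Data.List.Membership.Propositional using (_∈_)
open import Data.List.Relation.Unary.All using (All)
open import Data.List.Relation.Unary.Unique.Propositional using (Unique)
open import Data.Nat.Base using (ℕ; _≤_; _<_)
open import Data.Nat.Properties using (+-0-commutativeMonoid)
open import Data.Product.Base using (_×_; _,_; ∃-syntax; uncurry)
open import Data.Sum.Base using (_⊎_)
open import Data.Vec.Base using (count; tabulate)
open import Data.Vec.Properties using (tabulate-cong)
open import Function.Bundles using (_↔_; Inverse; _⇔_)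
open import Relation.Binary.Construct.Closure.ReflexiveTransitive using (Star)
open import Relation.Binary.PropositionalEquality
  using (_≡_; _≢_; refl; sym; trans; cong)
open import Relation.Nullary using (¬_; does; yes; no; contradiction)

-- Finite simple graphs with vertex set Fin n.
record Graph (n : ℕ) : Set where
  field
    adj       : Fin n → Fin n → Bool
    symmetric : ∀ u v → adj u v ≡ adj v u
    loopless  : ∀ v → adj v v ≡ false

  Adj : Fin n → Fin n → Set
  Adj u v = T (adj u v)

record _≅_ {m n : ℕ} (G : Graph m) (H : Graph n) : Set where
  field
    bijection : Fin m ↔ Fin n
    preserves : ∀ u v → Graph.adj G u v
                      ≡ Graph.adj H (Inverse.to bijection u) (Inverse.to bijection v)

infix 4 _≅_

complete : ∀ n → Graph n
complete n = record { adj = λ u v → not (does (u ≟ v)) ; symmetric = sy ; loopless = lo }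
  where
  sy : ∀ (u v : Fin n) → not (does (u ≟ v)) ≡ not (does (v ≟ u))
  sy u v with u ≟ v | v ≟ u
  ... | yes _ | yes _ = refl
  ... | no  _ | no  _ = refl
  ... | yes p | no  q = contradiction (sym p) q
  ... | no  p | yes q = contradiction (sym q) p

  lo : ∀ (v : Fin n) → not (does (v ≟ v)) ≡ false
  lo v with v ≟ v
  ... | yes _ = refl
  ... | no  p = contradiction refl p

-- The factor Fin n says that the graph has at least one vertex.
Connected : ∀ {n} → Graph n → Set
Connected {n} G = Fin n × (∀ u v → Star (Graph.Adj G) u v)

-- A cycle, presented by its vertices in cyclic order from an arbitrary starting
-- vertex; different presentations of one cycle are identified by SameCycle.
record Cycle {n : ℕ} (G : Graph n) : Set where
  field
    start : Fin n
    rest  : List (Fin n)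

  vertices : List (Fin n)
  vertices = start ∷ rest

  steps : List (Fin n × Fin n)
  steps = zip vertices (rest ++ [ start ])

  field
    length≥3 : 3 ≤ length vertices
    distinct : Unique vertices
    adjacent : All (uncurry (Graph.Adj G)) steps

  HasEdge : Fin n → Fin n → Set
  HasEdge u v = (u , v) ∈ steps ⊎ (v , u) ∈ steps

-- Equality as subgraphs; a cycle is determined by its edge set.
SameCycle : ∀ {n} {G : Graph n} → Cycle G → Cycle G → Set
SameCycle C D = ∀ u v → Cycle.HasEdge C u v ⇔ Cycle.HasEdge D u v

IsCactus : ∀ {n} → Graph n → Set
IsCactus G = ∀ (C D : Cycle G) → ¬ SameCycle C D → ∀ x y →
  x ∈ Cycle.vertices C → x ∈ Cycle.vertices D →
  y ∈ Cycle.vertices C → y ∈ Cycle.vertices D → x ≡ y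

-- Finite loopless multigraphs with vertex set Fin n. The single edges joining
-- u and v are indexed by Fin (mult u v).
record Multigraph (n : ℕ) : Set where
  field
    mult      : Fin n → Fin n → ℕ
    symmetric : ∀ u v → mult u v ≡ mult v u
    loopless  : ∀ v → mult v v ≡ 0

  degree : Fin n → ℕ
  degree v = sum +-0-commutativeMonoid (λ u → mult v u)

LocallyIrregular : ∀ {n} → Multigraph n → Set
LocallyIrregular M = ∀ u v → 0 < mult u v → degree u ≢ degree v
  where open Multigraph M

²_ : ∀ {n} → Graph n → Multigraph n
² G = record
  { mult      = λ u v → if adj u v then 2 else 0
  ; symmetric = λ u v → cong (if_then 2 else 0) (symmetric u v)
  ; loopless  = λ v → cong (if_then 2 else 0) (loopless v)
  }
  where open Graph G

infix 9 ²_

-- The i-th single edge from u to v is also the i-th single edge from v to u,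
-- so the two have the same color.
record Coloring {n : ℕ} (M : Multigraph n) (k : ℕ) : Set where
  open Multigraph M using (mult) renaming (symmetric to mult-symmetric)
  field
    color     : ∀ u v → Fin (mult u v) → Fin k
    symmetric : ∀ u v i → color u v i ≡ color v u (cast (mult-symmetric u v) i)

private
  count-cast : ∀ {k a b} (c : Fin k) (eq : a ≡ b)
               (f : Fin a → Fin k) (g : Fin b → Fin k) →
               (∀ i → f i ≡ g (cast eq i)) →
               count (_≟ c) (tabulate f) ≡ count (_≟ c) (tabulate g)
  count-cast c refl f g h = cong (count (_≟ c))
    (tabulate-cong (λ i → trans (h i) (cong g (cast-is-id refl i))))

  count-empty : ∀ {k a} (c : Fin k) → a ≡ 0 → (f : Fin a → Fin k) →
                count (_≟ c) (tabulate f) ≡ 0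
  count-empty c refl f = refl

colorClass : ∀ {n} {M : Multigraph n} {k} → Coloring M k → Fin k → Multigraph n
colorClass {M = M} φ c = record
  { mult      = λ u v → count (_≟ c) (tabulate (color u v))
  ; symmetric = λ u v → count-cast c (Multigraph.symmetric M u v)
                          (color u v) (color v u) (symmetric u v)
  ; loopless  = λ v → count-empty c (Multigraph.loopless M v) (color v v)
  }
  where open Coloring φ

IsLocallyIrregularColoring : ∀ {n} {M : Multigraph n} {k} → Coloring M k → Set
IsLocallyIrregularColoring φ = ∀ c → LocallyIrregular (colorClass φ c)

LocallyIrregularColorableWith : ∀ {n} → ℕ → Multigraph n → Set
LocallyIrregularColorableWith k M =
  ∃[ φ ] IsLocallyIrregularColoring {M = M} {k = k} φ

LocallyIrregularColorable : ∀ {n} → Multigraph n → Set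
LocallyIrregularColorable M = ∃[ k ] LocallyIrregularColorableWith k M

-- lir M = k, as a relation because lir is defined only for colorable M.
Lir : ∀ {n} → Multigraph n → ℕ → Set
Lir M k = LocallyIrregularColorableWith k M
        × (∀ j → LocallyIrregularColorableWith j M → k ≤ j)

{-# OPTIONS --safe #-}
module Submission where

-- Give every edge of G a label 0, 1 or 2, the number of its red single edges. If
-- the red degrees of two adjacent vertices differ in parity, so do the blue ones
-- (their sums are even) and the edge between them is fine whatever its label. In
-- a depth-first search tree of a cactus the fundamental cycles share no edges,
-- so a vertex has at most one neighbour above it besides its parent. Let the
-- parity of a vertex be opposite to that of this other neighbour if there is
-- one, and to that of its parent otherwise. Then only the tree edges below which
-- a cycle closes are critical, and they form a matching. Labels with prescribed
-- red parities are found from the leaves to the root, with a handshake argument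
-- at the root if the parities add up to an even number; along each cycle this
-- leaves the choice of one label 0 or 2, which can be made so that the critical
-- edge becomes fine.
--
-- If n is odd, the parities or their opposites add up to an even number. If n is
-- even, let ρ be a deepest vertex of a search tree. It has at most two
-- neighbours and G − ρ is connected of odd order; in a search tree from ρ no
-- neighbour of ρ is on a critical edge, and after the colouring of G − ρ the
-- edges at ρ can be given labels 0 or 2.

open import Defs
open import Data.Bool.Base using (Bool; true; false; T; if_then_else_; not; _∧_)
open import Data.Bool.Properties using (T-≡; T?; ¬-not) renaming (_≟_ to _≟ᵇ_)
open import Data.Empty using (⊥)
open import Data.Fin.Base using (Fin; zero; suc; toℕ; fromℕ<; punchIn; punchOut)
open import Data.Fin.Properties
  using (_≟_; any?; all?; toℕ-cast; toℕ<n; punchInᵢ≢i; punchIn-injective; punchIn-punchOut)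
open import Data.List.Base using (List; []; _∷_; [_]; _++_; length; zip; allFin)
open import Data.List.Properties using (∷-injectiveˡ; ∷-injectiveʳ)
open import Data.List.Membership.Propositional using (_∈_)
open import Data.List.Membership.Propositional.Properties
  using (∈-∃++; ∈-++⁺ˡ; ∈-++⁺ʳ; ∈-++⁻; ∈-allFin)
open import Data.List.Relation.Unary.All as All using (All; []; _∷_)
open import Data.List.Relation.Unary.AllPairs using ([]; _∷_)
open import Data.List.Relation.Unary.Any using (here; there)
open import Data.List.Relation.Unary.Unique.Propositional using (Unique)
open import Data.Nat.Base
  using (ℕ; zero; suc; _+_; _*_; _∸_; _≤_; _<_; _<ᵇ_; z≤n; s≤s; parity)
import Data.Nat.Properties as ℕ
open import Data.List.Extrema ℕ.≤-totalOrder using (argmax; f[xs]≤f[argmax])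
open import Data.Parity.Base as ℙ using (Parity; 0ℙ; 1ℙ; _⁻¹)
import Data.Parity.Properties as ℙ
open import Data.Product.Base using (_×_; _,_; proj₁; proj₂; ∃-syntax)
open import Data.Sum.Base using (_⊎_; inj₁; inj₂; [_,_]′)
open import Data.Vec.Base using (count; tabulate)
open import Data.Vec.Functional using (updateAt)
open import Data.Vec.Functional.Properties using (updateAt-updates; updateAt-minimal)
open import Function.Base using (_∘_; const; case_of_)
open import Function.Bundles using (Equivalence)
open import Function.Properties.Inverse using (↔-refl)
open import Relation.Binary.Construct.Closure.ReflexiveTransitive using (Star; ε; _◅_; _◅◅_; reverse)
open import Relation.Binary.PropositionalEquality
  using (_≡_; _≢_; refl; sym; trans; cong; cong₂; subst; subst₂; ≢-sym; module ≡-Reasoning)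
open import Relation.Nullary using (¬_; Dec; does; yes; no; contradiction)
open import Relation.Nullary.Decidable using (_×-dec_; _→-dec_; ¬?; decidable-stable)
open import Algebra.Properties.CommutativeMonoid.Sum ℕ.+-0-commutativeMonoid
  using (sum; sum-cong-≗; ∑-distrib-+; ∑-comm; sum-replicate-zero)
open import Algebra.Properties.CommutativeSemigroup ℕ.+-commutativeSemigroup using (interchange)

private variable
  n : ℕ

-- Finite sums over vertices and their parities.

single : Fin n → Fin n → ℕ → ℕ
single x u k = if does (x ≟ u) then k else 0

single-≡ : ∀ {x u : Fin n} k → x ≡ u → single x u k ≡ k
single-≡ {x = x} {u} k x≡u with x ≟ u
... | yes _ = refl
... | no x≢u = contradiction x≡u x≢u

single-≢ : ∀ {x u : Fin n} k → x ≢ u → single x u k ≡ 0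
single-≢ {x = x} {u} k x≢u with x ≟ u
... | yes x≡u = contradiction x≡u x≢u
... | no _ = refl

sum-single : ∀ (x : Fin n) k → sum (λ u → single x u k) ≡ k
sum-single {n = suc n} zero k =
  trans (cong (k +_) (sum-replicate-zero n)) (ℕ.+-identityʳ k)
sum-single (suc x) k = sum-single x k

sum-bump : ∀ {F F′ : Fin n → ℕ} x k → F′ x ≡ F x + k → (∀ u → u ≢ x → F′ u ≡ F u) →
           sum F′ ≡ sum F + k
sum-bump {F = F} {F′} x k at-x off-x = begin
  sum F′                             ≡⟨ sum-cong-≗ pointwise ⟩
  sum (λ u → F u + single x u k)     ≡⟨ ∑-distrib-+ F (λ u → single x u k) ⟩
  sum F + sum (λ u → single x u k)   ≡⟨ cong (sum F +_) (sum-single x k) ⟩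
  sum F + k                          ∎
  where
  open ≡-Reasoning
  pointwise : ∀ u → F′ u ≡ F u + single x u k
  pointwise u with x ≟ u
  ... | yes refl = at-x
  ... | no x≢u = trans (off-x u (≢-sym x≢u)) (sym (ℕ.+-identityʳ (F u)))

term≤sum : ∀ (F : Fin n → ℕ) x → F x ≤ sum F
term≤sum F zero = ℕ.m≤m+n _ _
term≤sum F (suc x) = ℕ.≤-trans (term≤sum (F ∘ suc) x) (ℕ.m≤n+m _ (F zero))

sum-ones : ∀ n → sum {n} (λ _ → 1) ≡ n
sum-ones zero = refl
sum-ones (suc n) = cong suc (sum-ones n)

parity-sum-cong : ∀ {F G : Fin n → ℕ} → (∀ v → parity (F v) ≡ parity (G v)) →
                  parity (sum F) ≡ parity (sum G)
parity-sum-cong {n = zero} F~G = refl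
parity-sum-cong {n = suc n} {F} {G} F~G = begin
  parity (F zero + sum (F ∘ suc))           ≡⟨ ℙ.+-homo-+ (F zero) _ ⟩
  parity (F zero) ℙ.+ parity (sum (F ∘ suc)) ≡⟨ cong₂ ℙ._+_ (F~G zero) (parity-sum-cong (F~G ∘ suc)) ⟩
  parity (G zero) ℙ.+ parity (sum (G ∘ suc)) ≡⟨ ℙ.+-homo-+ (G zero) _ ⟨
  parity (G zero + sum (G ∘ suc))           ∎
  where open ≡-Reasoning

parity-sum-even : ∀ {F : Fin n → ℕ} → (∀ v → parity (F v) ≡ 0ℙ) → parity (sum F) ≡ 0ℙ
parity-sum-even {n = n} even =
  trans (parity-sum-cong {G = λ _ → 0} even) (cong parity (sum-replicate-zero n))

-- Cancelling the equal parities of all other terms isolates the term at `r`. Together with an even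
-- degree sum, this yields the prescribed parity at the one vertex that has no upward edge to
-- adjust.
parity-remaining : ∀ {F G : Fin n → ℕ} r → (∀ v → v ≢ r → parity (F v) ≡ parity (G v)) →
                   parity (sum F) ≡ parity (sum G) → parity (F r) ≡ parity (G r)
parity-remaining {F = F} {G} zero F~G sums =
  ℙ.+-cancelʳ-≡ _ _ _ (begin
    parity (F zero) ℙ.+ parity (sum (F ∘ suc)) ≡⟨ ℙ.+-homo-+ (F zero) _ ⟨
    parity (sum F)                             ≡⟨ sums ⟩
    parity (sum G)                             ≡⟨ ℙ.+-homo-+ (G zero) _ ⟩
    parity (G zero) ℙ.+ parity (sum (G ∘ suc)) ≡⟨ cong (parity (G zero) ℙ.+_)
                                                   (parity-sum-cong (λ v → F~G (suc v) λ ())) ⟨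
    parity (G zero) ℙ.+ parity (sum (F ∘ suc)) ∎)
  where open ≡-Reasoning
parity-remaining {F = F} {G} (suc r) F~G sums =
  parity-remaining {F = F ∘ suc} {G ∘ suc} r (λ v v≢r → F~G (suc v) (λ { refl → v≢r refl }))
  (ℙ.+-cancelˡ-≡ (parity (F zero)) _ _ (begin
    parity (F zero) ℙ.+ parity (sum (F ∘ suc)) ≡⟨ ℙ.+-homo-+ (F zero) _ ⟨
    parity (sum F)                             ≡⟨ sums ⟩
    parity (sum G)                             ≡⟨ ℙ.+-homo-+ (G zero) _ ⟩
    parity (G zero) ℙ.+ parity (sum (G ∘ suc)) ≡⟨ cong (ℙ._+ parity (sum (G ∘ suc))) (F~G zero λ ()) ⟨
    parity (F zero) ℙ.+ parity (sum (G ∘ suc)) ∎))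
  where open ≡-Reasoning

-- Greedy construction of functions on the vertices.

infixl 9 _[_≔_]
_[_≔_] : {A : Set} → (Fin n → A) → Fin n → A → Fin n → A
f [ v ≔ a ] = updateAt f v (const a)

≔-at : {A : Set} (f : Fin n → A) (v : Fin n) (a : A) → (f [ v ≔ a ]) v ≡ a
≔-at f v a = updateAt-updates v f

≔-off : {A : Set} (f : Fin n → A) {v : Fin n} (a : A) {u : Fin n} → u ≢ v → (f [ v ≔ a ]) u ≡ f u
≔-off f {v} a {u} = updateAt-minimal u v f

module _ {A : Set} (a₀ : A) (rank : Fin n → ℕ) (P : Fin n → (Fin n → A) → Set)
  (local : ∀ v f g → f v ≡ g v → (∀ u → rank u < rank v → f u ≡ g u) → P v f → P v g)
  (choose : ∀ v f → ∃[ a ] P v (f [ v ≔ a ]))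
  where

  private
    Solves< : ℕ → (Fin n → A) → Set
    Solves< k f = ∀ v → rank v < k → P v f

    extend : ∀ k → ∃[ f ] Solves< k f → ∃[ f ] Solves< (suc k) f
    extend k (f , solves) = f′ , solves′
      where
      f′ : Fin n → A
      f′ v with rank v ℕ.≟ k
      ... | yes _ = proj₁ (choose v f)
      ... | no  _ = f v

      f′-at : ∀ v → rank v ≡ k → f′ v ≡ proj₁ (choose v f)
      f′-at v eq with rank v ℕ.≟ k
      ... | yes _ = refl
      ... | no ne = contradiction eq ne

      f′-below : ∀ v → rank v < k → f v ≡ f′ v
      f′-below v lt with rank v ℕ.≟ k
      ... | yes eq = contradiction eq (ℕ.<⇒≢ lt)
      ... | no _ = refl

      solves′ : Solves< (suc k) f′
      solves′ v lt with ℕ.m<1+n⇒m<n∨m≡n lt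
      ... | inj₁ <k = local v f f′ (f′-below v <k)
                        (λ u u<v → f′-below u (ℕ.<-trans u<v <k)) (solves v <k)
      -- The choice at `v` was made against `f`, which agrees with `f′` below rank `k` but perhaps
      -- not at other vertices of rank `k`; `local` ignores those.
      ... | inj₂ refl = local v (f [ v ≔ _ ]) f′
                          (trans (≔-at f v _) (sym (f′-at v refl)))
                          (λ u u<v → trans (≔-off f _ (λ { refl → ℕ.<-irrefl refl u<v }))
                                           (f′-below u u<v))
                          (proj₂ (choose v f))

    stage : ∀ k → ∃[ f ] Solves< k f
    stage zero = const a₀ , λ _ ()
    stage (suc k) = extend k (stage k)

  -- Values are fixed in order of increasing rank. A condition sees only its own vertex and vertices
  -- of smaller rank, so later choices cannot destroy it. The scheme serves for parities from the
  -- root downwards, for labels from the leaves upwards, and for the choices left along the cycles.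
  greedy : ∃[ f ] (∀ v → P v f)
  greedy = let f , ok = stage (suc (sum rank))
           in f , λ v → ok v (s≤s (term≤sum rank v))

-- Forests with at most two upward edges per vertex, and their labellings.

-- The neighbours of a vertex among its ancestors in a rooted forest: nothing,
-- its parent, or its parent and one further ancestor.
data Up (n : ℕ) : Set where
  none : Up n
  one  : (parent : Fin n) → Up n
  two  : (parent back : Fin n) → Up n

_∈ᵁ_ : Fin n → Up n → Set
y ∈ᵁ none    = ⊥
y ∈ᵁ one x   = y ≡ x
y ∈ᵁ two x w = y ≡ x ⊎ y ≡ w

infix 4 _∈ᵁ_

-- All that the labelling argument retains of a cactus and its search tree. It is also applied to
-- the graph minus a vertex, which then stays in the vertex set as an isolated vertex.
record Skeleton (n : ℕ) : Set where
  field
    up        : Fin n → Up n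
    depth     : Fin n → ℕ
    up-depth  : ∀ {y u} → y ∈ᵁ up u → depth y < depth u
    two-depth : ∀ {u x w} → up u ≡ two x w → depth w < depth x
    -- The edges from a vertex with two upper neighbours to its parent form a
    -- matching.
    separated : ∀ {u x w z x′ w′} → up u ≡ two x w → up z ≡ two x′ w′ →
                x′ ≡ u ⊎ x′ ≡ x ⊎ z ≡ x → z ≡ u

slot : Up n → ℕ × ℕ → Fin n → ℕ
slot none      _       v = 0
slot (one x)   (a , _) v = single x v a
slot (two x w) (a , b) v = single x v a + single w v b

total : Up n → ℕ × ℕ → ℕ
total none      _       = 0
total (one _)   (a , _) = a
total (two _ _) (a , b) = a + b

sum-slot : ∀ (U : Up n) ab → sum (slot U ab) ≡ total U ab
sum-slot {n = n} none _ = sum-replicate-zero n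
sum-slot (one x) (a , _) = sum-single x a
sum-slot (two x w) (a , b) =
  trans (∑-distrib-+ (λ v → single x v a) (λ v → single w v b))
        (cong₂ _+_ (sum-single x a) (sum-single w b))

slot-∉ : ∀ (U : Up n) ab {v} → ¬ v ∈ᵁ U → slot U ab v ≡ 0
slot-∉ none _ _ = refl
slot-∉ (one x) (a , _) v∉ = single-≢ a (v∉ ∘ sym)
slot-∉ (two x w) (a , b) v∉ =
  cong₂ _+_ (single-≢ a (v∉ ∘ inj₁ ∘ sym)) (single-≢ b (v∉ ∘ inj₂ ∘ sym))

slot-cong : ∀ (U : Up n) {ab cd v} → (v ∈ᵁ U → ab ≡ cd) → slot U ab v ≡ slot U cd v
slot-cong none eq = refl
slot-cong (one x) {ab} {cd} {v} eq with x ≟ v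
... | yes refl = cong proj₁ (eq refl)
... | no _ = refl
slot-cong (two x w) {ab} {cd} {v} eq with x ≟ v | w ≟ v
... | yes refl | _ = cong (λ (a , b) → a + (if _ then b else 0)) (eq (inj₁ refl))
... | no _ | yes refl = cong proj₂ (eq (inj₂ refl))
... | no _ | no _ = refl

single-+ : ∀ (x v : Fin n) a b → single x v a + single x v b ≡ single x v (a + b)
single-+ x v a b with x ≟ v
... | yes _ = refl
... | no _ = refl

slot-+ : ∀ (U : Up n) a b c d v →
         slot U (a , b) v + slot U (c , d) v ≡ slot U (a + c , b + d) v
slot-+ none a b c d v = refl
slot-+ (one x) a b c d v = single-+ x v a c
slot-+ (two x w) a b c d v =
  trans (interchange (single x v a) (single w v b) (single x v c) (single w v d))
        (cong₂ _+_ (single-+ x v a c) (single-+ w v b d))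

parity-single-2 : ∀ (x v : Fin n) → parity (single x v 2) ≡ 0ℙ
parity-single-2 x v with x ≟ v
... | yes _ = refl
... | no _ = refl

parity-+-even : ∀ m n → parity m ≡ 0ℙ → parity n ≡ 0ℙ → parity (m + n) ≡ 0ℙ
parity-+-even m n em en = trans (ℙ.+-homo-+ m n) (cong₂ ℙ._+_ em en)

parity-slot-2 : ∀ (U : Up n) v → parity (slot U (2 , 2) v) ≡ 0ℙ
parity-slot-2 none v = refl
parity-slot-2 (one x) v = parity-single-2 x v
parity-slot-2 (two x w) v =
  parity-+-even (single x v 2) _ (parity-single-2 x v) (parity-single-2 w v)

parity-split : ∀ a b → parity (a + b) ≡ 0ℙ → parity a ≡ parity b
parity-split a b even = ℙ.+-cancelʳ-≡ (parity b) _ _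
  (trans (sym (ℙ.+-homo-+ a b)) (trans even (sym (ℙ.p+p≡0ℙ (parity b)))))

⁻¹⇒≢ : ∀ {p q} → p ≡ q ⁻¹ → p ≢ q
⁻¹⇒≢ {q = q} p≡q⁻¹ p≡q = ℙ.p≢p⁻¹ q (trans (sym p≡q) p≡q⁻¹)

-- `mixed t` is odd exactly when `t` holds, so `t` alone steers the parities; `solid c` is even and
-- leaves `c` free for the critical edges.
mixed solid : Bool → ℕ
mixed t = if t then 1 else 2
solid c = if c then 2 else 0

parity-single-solid : ∀ (x v : Fin n) c → parity (single x v (solid c)) ≡ 0ℙ
parity-single-solid x v true = parity-single-2 x v
parity-single-solid x v false with x ≟ v
... | yes _ = refl
... | no _ = refl

Labels : ℕ → Set
Labels n = Fin n → ℕ × ℕ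

-- All single edges red: `Red full v` is the degree in the whole multigraph.
full : Labels n
full _ = 2 , 2

complement : Labels n → Labels n
complement g v = 2 ∸ proj₁ (g v) , 2 ∸ proj₂ (g v)

Bounded : Labels n → Set
Bounded g = ∀ v → proj₁ (g v) ≤ 2 × proj₂ (g v) ≤ 2

module Labelling (S : Skeleton n) where
  open Skeleton S

  up-irrefl : ∀ {v} → ¬ v ∈ᵁ up v
  up-irrefl v∈ = ℕ.<-irrefl refl (up-depth v∈)

  -- The number of red single edges between u and v: g v lists the red
  -- multiplicities of the edges from v to its upper neighbours.
  red : Labels n → Fin n → Fin n → ℕ
  red g u v = slot (up u) (g u) v + slot (up v) (g v) u

  red-sym : ∀ g u v → red g u v ≡ red g v u
  red-sym g u v = ℕ.+-comm (slot (up u) (g u) v) _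

  Red : Labels n → Fin n → ℕ
  Red g v = sum (red g v)

  Down : Labels n → Fin n → ℕ
  Down g v = sum (λ u → slot (up u) (g u) v)

  Blue : Labels n → Fin n → ℕ
  Blue g = Red (complement g)

  Red-split : ∀ g v → Red g v ≡ total (up v) (g v) + Down g v
  Red-split g v =
    trans (∑-distrib-+ (slot (up v) (g v)) _) (cong (_+ Down g v) (sum-slot (up v) (g v)))

  Red-cong : ∀ {g h v} → g v ≡ h v → (∀ u → v ∈ᵁ up u → g u ≡ h u) → Red g v ≡ Red h v
  Red-cong {g} {h} {v} at below = sum-cong-≗ λ u →
    cong₂ _+_ (slot-cong (up v) (λ _ → at)) (slot-cong (up u) (below u))

  red-complement : ∀ {g} → Bounded g → ∀ u v → red g u v + red (complement g) u v ≡ red full u v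
  red-complement {g} bounded u v =
    trans (interchange (slot (up u) (g u) v) (slot (up v) (g v) u) _ _)
          (cong₂ _+_ (half u v) (half v u))
    where
    half : ∀ u v → slot (up u) (g u) v + slot (up u) (complement g u) v ≡ slot (up u) (2 , 2) v
    half u v = trans (slot-+ (up u) _ _ _ _ v)
      (cong (λ ab → slot (up u) ab v)
        (cong₂ _,_ (ℕ.m+[n∸m]≡n (proj₁ (bounded u))) (ℕ.m+[n∸m]≡n (proj₂ (bounded u)))))

  Red+Blue : ∀ {g} → Bounded g → ∀ v → Red g v + Blue g v ≡ Red full v
  Red+Blue {g} bounded v =
    trans (sym (∑-distrib-+ (red g v) _)) (sum-cong-≗ (red-complement bounded v))

  -- Red and blue degree add up to the full degree, which is even because every multiedge has two
  -- copies.
  parity-Blue : ∀ {g} → Bounded g → ∀ v → parity (Red g v) ≡ parity (Blue g v)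
  parity-Blue {g} bounded v = parity-split (Red g v) _
    (trans (cong parity (Red+Blue bounded v))
      (parity-sum-even λ u → parity-+-even (slot (up v) (2 , 2) u) _
        (parity-slot-2 (up v) u) (parity-slot-2 (up u) v)))

  -- Both halves of the degree sum are the total of the matrix `A` of labels listed at lower ends,
  -- added once by rows and once by columns.
  handshake : ∀ g → parity (sum (Red g)) ≡ 0ℙ
  handshake g = begin
    parity (sum (Red g))   ≡⟨ cong parity (sum-cong-≗ λ v → ∑-distrib-+ (A v) (λ u → A u v)) ⟩
    parity (sum (λ v → sum (A v) + sum (λ u → A u v)))
                           ≡⟨ cong parity (∑-distrib-+ (sum ∘ A) _) ⟩
    parity (X + sum (λ v → sum (λ u → A u v)))
                           ≡⟨ cong (λ Y → parity (X + Y)) (∑-comm (λ v u → A u v)) ⟩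
    parity (X + X)         ≡⟨ ℙ.+-homo-+ X X ⟩
    parity X ℙ.+ parity X  ≡⟨ ℙ.p+p≡0ℙ (parity X) ⟩
    0ℙ                     ∎
    where
    open ≡-Reasoning
    A : Fin n → Fin n → ℕ
    A u v = slot (up u) (g u) v
    X = sum (λ v → sum (A v))

  -- The parities of two upper neighbours may differ, so only the edge to the second one is made to
  -- alternate; the edge to the parent becomes critical.
  Alternating : (Fin n → Parity) → Fin n → Set
  Alternating p v = (∀ x → up v ≡ one x → p v ≡ p x ⁻¹) × (∀ x w → up v ≡ two x w → p v ≡ p w ⁻¹)

  alternating : ∃[ p ] (∀ v → Alternating p v)
  alternating = greedy 0ℙ depth (λ v p → Alternating p v) local choose
    where
    upper : ∀ {v U y} → up v ≡ U → y ∈ᵁ U → depth y < depth v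
    upper eq y∈ = up-depth (subst (_ ∈ᵁ_) (sym eq) y∈)

    local : ∀ v p q → p v ≡ q v → (∀ u → depth u < depth v → p u ≡ q u) →
            Alternating p v → Alternating q v
    local v p q at below (alt₁ , alt₂) =
      (λ x eq → trans (sym at) (trans (alt₁ x eq) (cong _⁻¹ (below x (upper eq refl))))) ,
      (λ x w eq → trans (sym at) (trans (alt₂ x w eq) (cong _⁻¹ (below w (upper eq (inj₂ refl))))))

    choose : ∀ v p → ∃[ a ] Alternating (p [ v ≔ a ]) v
    choose v p with up v in eq
    ... | none = 0ℙ , (λ _ ()) , (λ _ _ ())
    ... | one x = p x ⁻¹ , (λ { _ refl → trans (≔-at p v _)
                    (cong _⁻¹ (sym (≔-off p _ λ { refl → ℕ.<-irrefl refl (upper eq refl) }))) }) , λ _ _ ()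
    ... | two x w = p w ⁻¹ , (λ _ ()) , (λ { _ _ refl → trans (≔-at p v _)
                    (cong _⁻¹ (sym (≔-off p _ λ { refl → ℕ.<-irrefl refl (upper eq (inj₂ refl)) }))) })

  -- The parities depend on t alone. If the critical edge, the one to the parent,
  -- has ends of equal degree, c sits on the back edge, where it changes the red
  -- degree of only one of the two ends. Otherwise c sits on the critical edge:
  -- the ends cannot agree in both their red and their blue degrees, and c avoids
  -- the colour in which they agree.
  label : Up n → Bool → Bool → Bool → ℕ × ℕ
  label none      _     t c = 0 , 0
  label (one _)   _     t c = mixed t , 0
  label (two _ _) true  t c = mixed t , solid c
  label (two _ _) false t c = solid c , mixed t

  balanced : Up n → Fin n → Bool
  balanced none u = false
  balanced (one _) u = false
  balanced (two x _) u = does (Red full u ℕ.≟ Red full x)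

  labels : (Fin n → Bool) → (Fin n → Bool) → Labels n
  labels t c v = label (up v) (balanced (up v) v) (t v) (c v)

  private
    mixed≤2 : ∀ t → mixed t ≤ 2
    mixed≤2 false = ℕ.≤-refl
    mixed≤2 true  = s≤s z≤n

    solid≤2 : ∀ c → solid c ≤ 2
    solid≤2 false = z≤n
    solid≤2 true  = ℕ.≤-refl

  bounded : ∀ t c → Bounded (labels t c)
  bounded t c v with up v
  ... | none = z≤n , z≤n
  ... | one _ = mixed≤2 (t v) , z≤n
  ... | two x _ with balanced (two x x) v
  ... | true  = mixed≤2 (t v) , solid≤2 (c v)
  ... | false = solid≤2 (c v) , mixed≤2 (t v)

-- Choosing labels with prescribed parities and irregular critical edges.

module Core (S : Skeleton n) where
  open Skeleton S
  open Labelling S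

  private
    N : ℕ
    N = sum depth

    -- `N` bounds every depth, so the truncated subtraction is exact; ranking by it makes `greedy`
    -- run from the leaves to the root.
    reverse-< : ∀ {u v} → depth u < depth v → N ∸ depth v < N ∸ depth u
    reverse-< {u} {v} lt = ℕ.∸-monoʳ-< lt (term≤sum depth v)

    below≢ : ∀ {u z} → u ∈ᵁ up z → z ≢ u
    below≢ u∈ refl = up-irrefl u∈

    toParity : Bool → Parity
    toParity false = 0ℙ
    toParity true  = 1ℙ

    fromParity : Parity → Bool
    fromParity 0ℙ = false
    fromParity 1ℙ = true

    toParity∘fromParity : ∀ q → toParity (fromParity q) ≡ q
    toParity∘fromParity 0ℙ = refl
    toParity∘fromParity 1ℙ = refl

    parity-label : ∀ U b t c c′ y → parity (slot U (label U b t c) y) ≡ parity (slot U (label U b t c′) y)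
    parity-label none _ _ _ _ _ = refl
    parity-label (one _) _ _ _ _ _ = refl
    parity-label (two x w) true t c c′ y =
      trans (ℙ.+-homo-+ (single x y (mixed t)) _)
      (trans (cong (parity (single x y (mixed t)) ℙ.+_)
               (trans (parity-single-solid w y c) (sym (parity-single-solid w y c′))))
             (sym (ℙ.+-homo-+ (single x y (mixed t)) _)))
    parity-label (two x w) false t c c′ y =
      trans (ℙ.+-homo-+ (single x y (solid c)) _)
      (trans (cong (ℙ._+ parity (single w y (mixed t)))
               (trans (parity-single-solid x y c) (sym (parity-single-solid x y c′))))
             (sym (ℙ.+-homo-+ (single x y (solid c′)) _)))

    parity-total : ∀ U b t → U ≢ none → parity (total U (label U b t false)) ≡ toParity t
    parity-total none _ _ U≢none = contradiction refl U≢none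
    parity-total (one _) _ false _ = refl
    parity-total (one _) _ true _ = refl
    parity-total (two _ _) false false _ = refl
    parity-total (two _ _) false true _ = refl
    parity-total (two _ _) true false _ = refl
    parity-total (two _ _) true true _ = refl

    labels-cong : ∀ t c c′ z → (∀ x w → up z ≡ two x w → c z ≡ c′ z) → labels t c z ≡ labels t c′ z
    labels-cong t c c′ z eq with up z
    ... | none = refl
    ... | one _ = refl
    ... | two x w = cong (label (two x w) (balanced (two x w) z) _) (eq x w refl)

  -- Changing `c` changes labels by 0 or 2 only. Hence the parities can be settled by `t` first and
  -- `c` chosen afterwards.
  parity-Red : ∀ t c c′ v → parity (Red (labels t c) v) ≡ parity (Red (labels t c′) v)
  parity-Red t c c′ v = parity-sum-cong λ u →
    trans (ℙ.+-homo-+ (slot (up v) (labels t c v) u) _)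
    (trans (cong₂ ℙ._+_ (parity-label (up v) _ (t v) (c v) (c′ v) u)
                        (parity-label (up u) _ (t u) (c u) (c′ u) v))
           (sym (ℙ.+-homo-+ (slot (up v) (labels t c′ v) u) _)))

  -- For a critical edge from `u` to its parent `x`, `proj₁ (g u)` is its red multiplicity, and a
  -- value below 2 leaves a blue copy.
  Compatible : Labels n → Fin n → Fin n → Set
  Compatible g u x = (0 < proj₁ (g u) → Red g u ≢ Red g x) × (proj₁ (g u) < 2 → Blue g u ≢ Blue g x)

  module _ (p : Fin n → Parity) where
    private
      Prescribed : Fin n → (Fin n → Bool) → Set
      Prescribed v t = up v ≢ none → parity (Red (labels t (const false)) v) ≡ p v

      labels-t : ∀ t t′ z → t z ≡ t′ z → labels t (const false) z ≡ labels t′ (const false) z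
      labels-t t t′ z eq = cong (λ b → label (up z) _ b _) eq

      local : ∀ v t t′ → t v ≡ t′ v → (∀ u → N ∸ depth u < N ∸ depth v → t u ≡ t′ u) →
              Prescribed v t → Prescribed v t′
      local v t t′ at below ok some = trans
        (cong parity (sym (Red-cong {labels t (const false)} {labels t′ (const false)}
          (labels-t t t′ v at) (λ u v∈ → labels-t t t′ u (below u (reverse-< (up-depth v∈)))))))
        (ok some)

      choose : ∀ v t → ∃[ a ] Prescribed v (t [ v ≔ a ])
      choose v t = a , λ some → begin
        parity (Red g v)                       ≡⟨ cong parity (Red-split g v) ⟩
        parity (total (up v) (g v) + Down g v) ≡⟨ ℙ.+-homo-+ (total (up v) (g v)) _ ⟩
        parity (total (up v) (g v)) ℙ.+ parity (Down g v)
          ≡⟨ cong₂ ℙ._+_ (trans (parity-total (up v) _ _ some) (cong toParity (≔-at t v a)))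
                         (cong parity same-Down) ⟩
        toParity a ℙ.+ D                       ≡⟨ cong (ℙ._+ D) (toParity∘fromParity (p v ℙ.+ D)) ⟩
        p v ℙ.+ D ℙ.+ D                        ≡⟨ ℙ.+-assoc (p v) D D ⟩
        p v ℙ.+ (D ℙ.+ D)                      ≡⟨ cong (p v ℙ.+_) (ℙ.p+p≡0ℙ D) ⟩
        p v ℙ.+ 0ℙ                             ≡⟨ ℙ.+-identityʳ (p v) ⟩
        p v                                    ∎
        where
        open ≡-Reasoning
        D = parity (Down (labels t (const false)) v)
        -- The upward edges must supply the difference between `p v` and the parity `D` coming from
        -- below; modulo 2 this is the sum.
        a = fromParity (p v ℙ.+ D)
        g = labels (t [ v ≔ a ]) (const false)
        same-Down : Down g v ≡ Down (labels t (const false)) v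
        same-Down = sum-cong-≗ λ u → slot-cong (up u)
          (λ v∈ → labels-t (t [ v ≔ a ]) t u (≔-off t a (below≢ v∈)))

    -- Once the edges from below are labelled, the `mixed` label on an upward edge of `v` can still
    -- correct the parity at `v`. Its effect on the upper neighbour is taken into account there,
    -- later.
    prescribed : ∃[ t ] (∀ v → up v ≢ none → ∀ c → parity (Red (labels t c) v) ≡ p v)
    prescribed =
      let t , ok = greedy false (λ v → N ∸ depth v) Prescribed local choose
      in t , λ v some c → trans (parity-Red t c (const false) v) (ok v some)

  module _ (t : Fin n → Bool) where
    private
      Settled : Fin n → (Fin n → Bool) → Set
      Settled u c = ∀ x w → up u ≡ two x w → Compatible (labels t c) u x

      -- A choice at z affects the critical edge of u ≠ z only if the back edge of
      -- z ends at an end of that edge, which is deeper than the end of the back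
      -- edge of u.
      rank : Up n → ℕ
      rank (two _ w) = suc (N ∸ depth w)
      rank _         = 0

      local : ∀ u c c′ → c u ≡ c′ u → (∀ z → rank (up z) < rank (up u) → c z ≡ c′ z) →
              Settled u c → Settled u c′
      local u c c′ at below settled x w eq =
        (λ pos Reds → proj₁ compatible (subst (0 <_) (cong proj₁ (sym same-u)) pos)
           (trans Red-u (trans Reds (sym Red-x)))) ,
        (λ lt Blues → proj₂ compatible (subst (_< 2) (cong proj₁ (sym same-u)) lt)
           (trans Blue-u (trans Blues (sym Blue-x))))
        where
        g g′ : Labels n
        g = labels t c
        g′ = labels t c′
        compatible = settled x w eq

        w<x : depth w < depth x
        w<x = two-depth eq

        x<u : depth x < depth u
        x<u = up-depth (subst (x ∈ᵁ_) (sym eq) (inj₁ refl))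

        earlier : ∀ {z x′ w′} → up z ≡ two x′ w′ → depth w < depth w′ → c z ≡ c′ z
        earlier {z} eq′ lt = below z
          (subst₂ (λ U V → rank U < rank V) (sym eq′) (sym eq) (s≤s (reverse-< lt)))

        same-u : g u ≡ g′ u
        same-u = labels-cong t c c′ u λ _ _ _ → at

        same-x : g x ≡ g′ x
        -- `x` has no back edge of its own: otherwise its parent edge would be critical and meet the
        -- critical edge at `u`.
        same-x = labels-cong t c c′ x λ x′ w′ eq′ →
          contradiction (cong depth (separated eq eq′ (inj₂ (inj₂ refl)))) (ℕ.<⇒≢ x<u)

        below-u : ∀ z → u ∈ᵁ up z → g z ≡ g′ z
        -- If `u` is the parent of `z`, the matching property forces `z` to be `u`. If the back edge
        -- of `z` ends at `u`, it ends deeper than `w`, so `z` was decided earlier.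
        below-u z u∈ = labels-cong t c c′ z λ x′ w′ eq′ → case subst (u ∈ᵁ_) eq′ u∈ of λ where
          (inj₁ refl) → subst (λ z → c z ≡ c′ z) (sym (separated eq eq′ (inj₁ refl))) at
          (inj₂ refl) → earlier eq′ (ℕ.<-trans w<x x<u)

        below-x : ∀ z → x ∈ᵁ up z → g z ≡ g′ z
        below-x z x∈ = labels-cong t c c′ z λ x′ w′ eq′ → case subst (x ∈ᵁ_) eq′ x∈ of λ where
          (inj₁ refl) → subst (λ z → c z ≡ c′ z) (sym (separated eq eq′ (inj₂ (inj₁ refl)))) at
          (inj₂ refl) → earlier eq′ w<x

        complementary : ∀ z → g z ≡ g′ z → complement g z ≡ complement g′ z
        complementary z = cong (λ (a , b) → 2 ∸ a , 2 ∸ b)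

        Red-u : Red g u ≡ Red g′ u
        Red-u = Red-cong same-u below-u
        Red-x : Red g x ≡ Red g′ x
        Red-x = Red-cong same-x below-x
        Blue-u : Blue g u ≡ Blue g′ u
        Blue-u = Red-cong (complementary u same-u) (λ z u∈ → complementary z (below-u z u∈))
        Blue-x : Blue g x ≡ Blue g′ x
        Blue-x = Red-cong (complementary x same-x) (λ z x∈ → complementary z (below-x z x∈))

      choose-two : ∀ u c {x w} → up u ≡ two x w → ∃[ a ] Compatible (labels t (c [ u ≔ a ])) u x
      choose-two u c {x} {w} eq = by-balance (Red full u ℕ.≟ Red full x) own
        where
        g : Bool → Labels n
        g a = labels t (c [ u ≔ a ])

        off : ∀ {z} a b → z ≢ u → g a z ≡ g b z
        off {z} a b z≢u = cong (label (up z) _ _) (trans (≔-off c a z≢u) (sym (≔-off c b z≢u)))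

        own : ∀ a → g a u ≡ label (two x w) (does (Red full u ℕ.≟ Red full x)) (t u) a
        own a = trans (cong (λ U → label U (balanced U u) (t u) ((c [ u ≔ a ]) u)) eq)
                      (cong (label (two x w) _ (t u)) (≔-at c u a))

        x<u : depth x < depth u
        x<u = up-depth (subst (x ∈ᵁ_) (sym eq) (inj₁ refl))

        x≢u : x ≢ u
        x≢u refl = ℕ.<-irrefl refl x<u

        w≢x : w ≢ x
        w≢x refl = ℕ.<-irrefl refl (two-depth eq)

        Red-u : ∀ a → Red (g a) u ≡ proj₁ (g a u) + proj₂ (g a u) + Down (g false) u
        Red-u a = trans (Red-split (g a) u)
          (cong₂ _+_ (cong (λ U → total U (g a u)) eq)
                     (sum-cong-≗ λ z → slot-cong (up z) (λ u∈ → off a false (below≢ u∈))))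

        slot-x : ∀ a → slot (up u) (g a u) x ≡ proj₁ (g a u)
        slot-x a = trans (cong (λ U → slot U (g a u) x) eq)
          (trans (cong₂ _+_ (single-≡ {x = x} (proj₁ (g a u)) refl) (single-≢ (proj₂ (g a u)) w≢x))
                 (ℕ.+-identityʳ _))

        Red-x : ∀ δ → proj₁ (g true u) ≡ proj₁ (g false u) + δ → Red (g true) x ≡ Red (g false) x + δ
        Red-x δ step = begin
          Red (g true) x                              ≡⟨ Red-split (g true) x ⟩
          total (up x) (g true x) + Down (g true) x
            ≡⟨ cong₂ _+_ (cong (total (up x)) (off true false x≢u))
                 (sum-bump u δ (trans (slot-x true) (trans step (cong (_+ δ) (sym (slot-x false)))))
                   λ z z≢u → cong (λ ab → slot (up z) ab x) (off true false z≢u)) ⟩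
          total (up x) (g false x) + (Down (g false) x + δ) ≡⟨ ℕ.+-assoc (total (up x) (g false x)) _ δ ⟨
          total (up x) (g false x) + Down (g false) x + δ ≡⟨ cong (_+ δ) (Red-split (g false) x) ⟨
          Red (g false) x + δ                         ∎
          where open ≡-Reasoning

        Red+Blue-g : ∀ a v → Red (g a) v + Blue (g a) v ≡ Red full v
        Red+Blue-g a = Red+Blue (bounded t (c [ u ≔ a ]))

        +2 : ∀ i d → i + 2 + d ≡ i + d + 2
        +2 i d = trans (ℕ.+-assoc i 2 d) (trans (cong (i +_) (ℕ.+-comm 2 d)) (sym (ℕ.+-assoc i d 2)))

        balanced⇒compatible : Red full u ≡ Red full x → ∀ a →
                              Red (g a) u ≢ Red (g a) x → Compatible (g a) u x
        balanced⇒compatible balance a Reds≢ = const Reds≢ , λ _ Blues →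
          Reds≢ (ℕ.+-cancelʳ-≡ (Blue (g a) u) _ _ (begin
            Red (g a) u + Blue (g a) u  ≡⟨ Red+Blue-g a u ⟩
            Red full u                  ≡⟨ balance ⟩
            Red full x                  ≡⟨ Red+Blue-g a x ⟨
            Red (g a) x + Blue (g a) x  ≡⟨ cong (Red (g a) x +_) (sym Blues) ⟩
            Red (g a) x + Blue (g a) u  ∎))
          where open ≡-Reasoning

        -- The decision is an argument together with the label it produces, so that matching on it
        -- makes the label of `u` explicit.
        by-balance : (d : Dec (Red full u ≡ Red full x)) →
                     (∀ a → g a u ≡ label (two x w) (does d) (t u) a) →
                     ∃[ a ] Compatible (g a) u x
        by-balance (yes balance) own with Red (g false) u ℕ.≟ Red (g false) x
        ... | no Reds≢ = false , balanced⇒compatible balance false Reds≢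
        -- Turning the back edge red adds 2 to the red degree of `u` and nothing to that of `x`, so
        -- equality cannot persist.
        ... | yes Reds = true , balanced⇒compatible balance true λ Reds′ → ℕ.m≢1+m+n (Red (g false) u) (begin
            Red (g false) u       ≡⟨ Reds ⟩
            Red (g false) x       ≡⟨ ℕ.+-identityʳ _ ⟨
            Red (g false) x + 0   ≡⟨ Red-x 0 first ⟨
            Red (g true) x        ≡⟨ Reds′ ⟨
            Red (g true) u        ≡⟨ step ⟩
            Red (g false) u + 2   ≡⟨ ℕ.+-suc (Red (g false) u) 1 ⟩
            suc (Red (g false) u + 1) ∎)
          where
          open ≡-Reasoning
          first : proj₁ (g true u) ≡ proj₁ (g false u) + 0
          first rewrite own true | own false = sym (ℕ.+-identityʳ _)
          step : Red (g true) u ≡ Red (g false) u + 2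
          step rewrite Red-u true | Red-u false | own true | own false =
            trans (+2 (mixed (t u)) _) (cong (λ i → i + Down (g false) u + 2) (sym (ℕ.+-identityʳ (mixed (t u)))))
        by-balance (no unbalanced) own with Red (g true) u ℕ.≟ Red (g true) x
        -- With `true` the critical edge is entirely red, so only red degrees matter.
        ... | no Reds≢ = true , const Reds≢ , λ lt → contradiction lt (ℕ.<-irrefl (cong proj₁ (own true)))
        -- With `false` it is entirely blue. Both ends lose 2 from their red degrees, which still
        -- agree, so unequal full degrees force unequal blue ones.
        ... | yes Reds = false ,
            (λ pos → contradiction pos (ℕ.<-irrefl (sym (cong proj₁ (own false))))) ,
            λ _ Blues → unbalanced (begin
              Red full u                          ≡⟨ Red+Blue-g false u ⟨
              Red (g false) u + Blue (g false) u  ≡⟨ cong₂ _+_ Reds-false Blues ⟩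
              Red (g false) x + Blue (g false) x  ≡⟨ Red+Blue-g false x ⟩
              Red full x                          ∎)
          where
          open ≡-Reasoning
          first : proj₁ (g true u) ≡ proj₁ (g false u) + 2
          first rewrite own true | own false = refl
          step : Red (g true) u ≡ Red (g false) u + 2
          step rewrite Red-u true | Red-u false | own true | own false =
            ℕ.+-comm 2 (mixed (t u) + Down (g false) u)
          Reds-false : Red (g false) u ≡ Red (g false) x
          Reds-false = ℕ.+-cancelʳ-≡ 2 _ _ (trans (sym step) (trans Reds (Red-x 2 first)))

      choose : ∀ u c → ∃[ a ] Settled u (c [ u ≔ a ])
      choose u c = by-shape (up u) refl
        where
        by-shape : ∀ U → up u ≡ U → ∃[ a ] Settled u (c [ u ≔ a ])
        by-shape none eq = false , λ _ _ eq′ → case trans (sym eq) eq′ of λ ()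
        by-shape (one _) eq = false , λ _ _ eq′ → case trans (sym eq) eq′ of λ ()
        by-shape (two x w) eq = let a , compatible = choose-two u c eq
                                in a , λ _ _ eq′ → case trans (sym eq) eq′ of λ { refl → compatible }

    settled : ∃[ c ] (∀ u x w → up u ≡ two x w → Compatible (labels t c) u x)
    settled = greedy false (rank ∘ up) Settled local choose

  record Solution (p : Fin n → Parity) : Set where
    field
      g          : Labels n
      g-bounded  : Bounded g
      g-parity   : ∀ v → up v ≢ none → parity (Red g v) ≡ p v
      compatible : ∀ u x w → up u ≡ two x w → Compatible g u x

  solve : ∀ p → Solution p
  solve p =
    let t , parities = prescribed p
        c , ok = settled t
    in record { g = labels t c ; g-bounded = bounded t c
              ; g-parity = λ v some → parities v some c ; compatible = ok }

-- Depth-first search.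

module _ (G : Graph n) where
  open Graph G

  Adj-sym : ∀ {u v} → Adj u v → Adj v u
  Adj-sym {u} {v} = subst T (symmetric u v)

  Adj-irrefl : ∀ {v} → ¬ Adj v v
  Adj-irrefl {v} = subst T (loopless v)

  -- A depth-first search tree: anc v lists the proper ancestors of v, parent
  -- first.
  record DFSTree (root : Fin n) : Set where
    field
      anc      : Fin n → List (Fin n)
      anc-root : anc root ≡ []
      shape    : ∀ v → v ≡ root ⊎ (∃[ x ] (anc v ≡ x ∷ anc x × Adj v x))
      normal   : ∀ u v → Adj u v → u ∈ anc v ⊎ v ∈ anc u

  module Search (root : Fin n) where

    -- The stack is the tree path from the current vertex up to the root. `finished` is the
    -- invariant that preserves `normal` when a vertex is added.
    record State (stack : List (Fin n)) : Set where
      field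
        seen      : Fin n → Bool
        anc       : Fin n → List (Fin n)
        seen-root : seen root ≡ true
        anc-root  : anc root ≡ []
        shape     : ∀ v → seen v ≡ true →
                    v ≡ root ⊎ (∃[ x ] (seen x ≡ true × anc v ≡ x ∷ anc x × Adj v x))
        top       : stack ≡ [] ⊎ (∃[ v ] (seen v ≡ true × stack ≡ v ∷ anc v))
        finished  : ∀ v → seen v ≡ true → v ∈ stack ⊎ (∀ u → Adj v u → seen u ≡ true)
        normal    : ∀ u v → seen u ≡ true → seen v ≡ true → Adj u v → u ∈ anc v ⊎ v ∈ anc u

      unseen : Fin n → ℕ
      unseen v = if seen v then 0 else 1

    State-top : ∀ {v s} (st : State (v ∷ s)) → State.seen st v ≡ true × s ≡ State.anc st v
    State-top st with State.top st
    ... | inj₂ (x , sx , eq) with refl ← ∷-injectiveˡ eq = sx , ∷-injectiveʳ eq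

    start : State [ root ]
    start = record
      { seen = seen₀ ; anc = const []
      ; seen-root = ≔-at (const false) root true ; anc-root = refl
      ; shape = λ v s → inj₁ (only v s)
      ; top = inj₂ (root , ≔-at (const false) root true , refl)
      ; finished = λ v s → inj₁ (here (only v s))
      ; normal = λ u v su sv uv → contradiction
          (subst₂ Adj (only u su) (only v sv) uv) Adj-irrefl
      }
      where
      seen₀ : Fin n → Bool
      seen₀ = const false [ root ≔ true ]
      only : ∀ v → seen₀ v ≡ true → v ≡ root
      only v s with v ≟ root
      ... | yes v≡r = v≡r
      ... | no v≢r = case trans (sym (≔-off (const false) true v≢r)) s of λ ()

    push : ∀ {v s w} (st : State (v ∷ s)) → Adj v w → State.seen st w ≡ false → State (w ∷ v ∷ s)
    push {v} {s} {w} st vw fresh = record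
      { seen = seen′ ; anc = anc′
      ; seen-root = mono seen-root ; anc-root = trans (old-anc seen-root) anc-root
      ; shape = shape′
      ; top = inj₂ (w , ≔-at seen w true , cong (w ∷_) (sym (≔-at anc w (v ∷ s))))
      ; finished = finished′
      ; normal = normal′
      }
      where
      open State st
      seen′ : Fin n → Bool
      seen′ = seen [ w ≔ true ]
      anc′ : Fin n → List (Fin n)
      anc′ = anc [ w ≔ v ∷ s ]

      old : ∀ {y} → seen y ≡ true → y ≢ w
      old sy refl = case trans (sym sy) fresh of λ ()
      mono : ∀ {y} → seen y ≡ true → seen′ y ≡ true
      mono sy = trans (≔-off seen true (old sy)) sy
      old-anc : ∀ {y} → seen y ≡ true → anc′ y ≡ anc y
      old-anc sy = ≔-off anc (v ∷ s) (old sy)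
      is-old : ∀ {y} → y ≢ w → seen′ y ≡ true → seen y ≡ true
      is-old y≢w s′y = trans (sym (≔-off seen true y≢w)) s′y

      v-top : seen v ≡ true × s ≡ anc v
      v-top = State-top st

      shape′ : ∀ y → seen′ y ≡ true →
               y ≡ root ⊎ (∃[ x ] (seen′ x ≡ true × anc′ y ≡ x ∷ anc′ x × Adj y x))
      shape′ y s′y with y ≟ w
      ... | yes refl = inj₂ (v , mono (proj₁ v-top) ,
              trans (≔-at anc w (v ∷ s))
                (cong (v ∷_) (trans (proj₂ v-top) (sym (old-anc (proj₁ v-top))))) ,
              Adj-sym vw)
      ... | no y≢w with shape y (is-old y≢w s′y)
      ... | inj₁ y≡root = inj₁ y≡root
      ... | inj₂ (x , sx , eq , yx) = inj₂ (x , mono sx ,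
              trans (old-anc (is-old y≢w s′y)) (trans eq (cong (x ∷_) (sym (old-anc sx)))) , yx)

      finished′ : ∀ y → seen′ y ≡ true → y ∈ w ∷ v ∷ s ⊎ (∀ u → Adj y u → seen′ u ≡ true)
      finished′ y s′y with y ≟ w
      ... | yes y≡w = inj₁ (here y≡w)
      ... | no y≢w with finished y (is-old y≢w s′y)
      ... | inj₁ y∈ = inj₁ (there y∈)
      ... | inj₂ done = inj₂ λ u yu → mono (done u yu)

      -- A seen vertex off the stack has no unseen neighbour, but `w` is still unseen; so its seen
      -- neighbours lie on the stack, which becomes its list of ancestors.
      on-stack : ∀ y → seen y ≡ true → Adj y w → y ∈ anc′ w
      on-stack y sy yw with finished y sy
      ... | inj₁ y∈ = subst (y ∈_) (sym (≔-at anc w (v ∷ s))) y∈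
      ... | inj₂ done = contradiction refl (old (done w yw))

      normal′ : ∀ x y → seen′ x ≡ true → seen′ y ≡ true → Adj x y → x ∈ anc′ y ⊎ y ∈ anc′ x
      normal′ x y s′x s′y xy with x ≟ w | y ≟ w
      ... | yes refl | yes refl = contradiction xy Adj-irrefl
      ... | yes refl | no y≢w = inj₂ (on-stack y (is-old y≢w s′y) (Adj-sym xy))
      ... | no x≢w | yes refl = inj₁ (on-stack x (is-old x≢w s′x) xy)
      ... | no x≢w | no y≢w =
        let sx = is-old x≢w s′x ; sy = is-old y≢w s′y in
        subst₂ (λ as bs → x ∈ as ⊎ y ∈ bs) (sym (old-anc sy)) (sym (old-anc sx)) (normal x y sx sy xy)

    pop : ∀ {v s} (st : State (v ∷ s)) → (∀ w → Adj v w → State.seen st w ≡ true) → State s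
    pop {v} {s} st done = record
      { State st hiding (top; finished) ; top = top′ ; finished = finished′ }
      where
      open State st
      top′ : s ≡ [] ⊎ (∃[ x ] (seen x ≡ true × s ≡ x ∷ anc x))
      top′ with sv , s≡ ← State-top st with shape v sv
      ... | inj₁ v≡root = inj₁ (trans s≡ (trans (cong anc v≡root) anc-root))
      ... | inj₂ (x , sx , eq , _) = inj₂ (x , sx , trans s≡ eq)
      finished′ : ∀ y → seen y ≡ true → y ∈ s ⊎ (∀ u → Adj y u → seen u ≡ true)
      finished′ y sy with finished y sy
      ... | inj₁ (here refl) = inj₂ done
      ... | inj₁ (there y∈) = inj₁ y∈
      ... | inj₂ done = inj₂ done

    -- `k` counts the unseen vertices: a push lowers it, and a pop keeps it while shortening the
    -- stack.
    run : ∀ k stack (st : State stack) → sum (State.unseen st) ≡ k → State []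
    run k [] st _ = st
    run k (v ∷ s) st count with any? (λ w → T? (adj v w) ×-dec State.seen st w ≟ᵇ false)
    ... | no none-fresh = run k s (pop st done) count
      where
      done : ∀ w → Adj v w → State.seen st w ≡ true
      done w vw with State.seen st w in eq
      ... | true = refl
      ... | false = contradiction (w , vw , eq) none-fresh
    run zero (v ∷ s) st count | yes (w , vw , fresh) =
      contradiction (subst₂ _≤_ (cong (λ b → if b then 0 else 1) fresh) count
                      (term≤sum (State.unseen st) w)) λ ()
    run (suc k) (v ∷ s) st count | yes (w , vw , fresh) =
      run k (w ∷ v ∷ s) (push st vw fresh)
        (ℕ.suc-injective (trans (ℕ.+-comm 1 _) (trans (sym bump) count)))
      where
      bump : sum (State.unseen st) ≡ sum (State.unseen (push st vw fresh)) + 1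
      bump = sum-bump w 1
        (trans (cong (λ b → if b then 0 else 1) fresh)
               (cong (λ b → (if b then 0 else 1) + 1) (sym (≔-at (State.seen st) w true))))
        (λ u u≢w → cong (λ b → if b then 0 else 1) (sym (≔-off (State.seen st) true u≢w)))

    final : State []
    final = run _ [ root ] start refl

    tree : (∀ v → Star Adj root v) → DFSTree root
    tree reachable = record
      { anc = anc ; anc-root = anc-root
      ; shape = λ v → case shape v (all-seen v) of λ where
          (inj₁ v≡root) → inj₁ v≡root
          (inj₂ (x , _ , eq , vx)) → inj₂ (x , eq , vx)
      ; normal = λ u v → normal u v (all-seen u) (all-seen v)
      }
      where
      open State final
      -- With the stack empty every seen vertex is finished, so the set of seen vertices is closed
      -- under adjacency.
      spread : ∀ {u v} → seen u ≡ true → Star Adj u v → seen v ≡ true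
      spread su ε = su
      spread {u} su (uw ◅ path) with finished u su
      ... | inj₂ done = spread (done _ uw) path
      all-seen : ∀ v → seen v ≡ true
      all-seen v = spread seen-root (reachable v)

-- Fundamental cycles of a search tree in a cactus.

module TreeProperties (G : Graph n) {root : Fin n} (tree : DFSTree G root) where
  open Graph G
  open DFSTree tree
  open import Data.List.Membership.DecPropositional (_≟_ {n}) using (_∈?_)

  depth : Fin n → ℕ
  depth v = length (anc v)

  Parent : Fin n → Fin n → Set
  Parent v x = anc v ≡ x ∷ anc x

  unfold : ∀ {v x xs} → anc v ≡ x ∷ xs → xs ≡ anc x × Adj v x
  unfold {v} eq with shape v
  ... | inj₁ refl = case trans (sym anc-root) eq of λ ()
  ... | inj₂ (y , eq′ , vy) with refl ← ∷-injectiveˡ (trans (sym eq) eq′) =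
    ∷-injectiveʳ (trans (sym eq) eq′) , vy

  toParent : ∀ {v x xs} → anc v ≡ x ∷ xs → Parent v x
  toParent {x = x} eq = trans eq (cong (x ∷_) (proj₁ (unfold eq)))

  hasParent : ∀ {v y} → y ∈ anc v → ∃[ x ] Parent v x
  hasParent {v} y∈ with shape v
  ... | inj₁ refl = case subst (_ ∈_) anc-root y∈ of λ ()
  ... | inj₂ (x , eq , _) = x , eq

  parent∈ : ∀ {v x} → Parent v x → x ∈ anc v
  parent∈ vx = subst (_ ∈_) (sym vx) (here refl)

  private
    -- The recursion, here and in the next helpers, runs over the list of ancestors, since a parent
    -- is not structurally smaller than its child.
    depth-go : ∀ xs {v y} → anc v ≡ xs → y ∈ xs → depth y < depth v
    depth-go (x ∷ xs) eq (here refl) =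
      subst (depth x <_) (sym (cong length (toParent eq))) ℕ.≤-refl
    depth-go (x ∷ xs) eq (there y∈) =
      ℕ.<-trans (depth-go xs (sym (proj₁ (unfold eq))) y∈) (depth-go (x ∷ xs) eq (here refl))

    trans-go : ∀ xs {v x y} → anc v ≡ xs → x ∈ anc y → y ∈ xs → x ∈ anc v
    trans-go (z ∷ xs) {x = x} eq x∈ y∈ = subst (x ∈_) (sym eq) (there (case y∈ of λ where
      (here refl) → subst (x ∈_) (sym (proj₁ (unfold eq))) x∈
      (there y∈) → subst (x ∈_) (sym (proj₁ (unfold eq)))
                     (trans-go xs (sym (proj₁ (unfold eq))) x∈ y∈)))

    comparable-go : ∀ xs {v x y} → anc v ≡ xs → x ∈ v ∷ xs → y ∈ v ∷ xs →
                    x ∈ y ∷ anc y ⊎ y ∈ x ∷ anc x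
    comparable-go xs eq (here refl) y∈ = inj₂ (subst (λ xs → _ ∈ _ ∷ xs) (sym eq) y∈)
    comparable-go xs eq x∈ (here refl) = inj₁ (subst (λ xs → _ ∈ _ ∷ xs) (sym eq) x∈)
    comparable-go (z ∷ xs) eq (there x∈) (there y∈) =
      comparable-go xs (sym (proj₁ (unfold eq))) x∈ y∈

  anc-depth : ∀ {v y} → y ∈ anc v → depth y < depth v
  anc-depth = depth-go _ refl

  anc-trans : ∀ {v x y} → x ∈ anc y → y ∈ anc v → x ∈ anc v
  anc-trans = trans-go _ refl

  comparable : ∀ {v x y} → x ∈ v ∷ anc v → y ∈ v ∷ anc v → x ∈ y ∷ anc y ⊎ y ∈ x ∷ anc x
  comparable = comparable-go _ refl

  anc-asym : ∀ {u v} → u ∈ anc v → ¬ v ∈ anc u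
  anc-asym u∈ v∈ = ℕ.<-asym (anc-depth u∈) (anc-depth v∈)

  anc⇒≢ : ∀ {u v} → u ∈ anc v → u ≢ v
  anc⇒≢ u∈ refl = anc-asym u∈ u∈

  record BackEdge (v w : Fin n) : Set where
    field
      parent   : Fin n
      isParent : Parent v parent
      ancestor : w ∈ anc parent
      back     : Adj v w

    back∈ : w ∈ anc v
    back∈ = anc-trans ancestor (parent∈ isParent)

  private
    module _ {v₀ w} (v₀w : Adj v₀ w) where
      -- This records more than adjacency: telling the tree edges of a fundamental cycle from its
      -- closing edge is what later recovers the back edge from the cycle.
      Step : Fin n × Fin n → Set
      Step (y , y′) = Parent y y′ ⊎ (y ≡ w × y′ ≡ v₀)

      step-adj : ∀ {yy′} → Step yy′ → Adj (proj₁ yy′) (proj₂ yy′)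
      step-adj (inj₁ yy′) = proj₂ (unfold yy′)
      step-adj (inj₂ (refl , refl)) = Adj-sym G v₀w

      all-steps : ∀ us {v zs} → anc v ≡ us ++ w ∷ zs →
                  All Step (zip (v ∷ us ++ [ w ]) ((us ++ [ w ]) ++ [ v₀ ]))
      all-steps [] eq = inj₁ (toParent eq) ∷ inj₂ (refl , refl) ∷ []
      all-steps (u ∷ us) eq = inj₁ (toParent eq) ∷ all-steps us (sym (proj₁ (unfold eq)))

      closing : ∀ us {v} → (w , v₀) ∈ zip (v ∷ us ++ [ w ]) ((us ++ [ w ]) ++ [ v₀ ])
      closing [] = there (here refl)
      closing (u ∷ us) = there (closing us)

      unique : ∀ us {v zs} → anc v ≡ us ++ w ∷ zs → Unique (v ∷ us ++ [ w ])
      unique us {v} {zs} eq =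
        All.tabulate (λ y∈ → ≢-sym (anc⇒≢ (subst (_ ∈_) (sym eq) (prefix us y∈)))) ∷ tail us eq
        where
        prefix : ∀ us {y} → y ∈ us ++ [ w ] → y ∈ us ++ w ∷ zs
        prefix us y∈ with ∈-++⁻ us y∈
        ... | inj₁ y∈us = ∈-++⁺ˡ y∈us
        ... | inj₂ (here refl) = ∈-++⁺ʳ us (here refl)
        tail : ∀ us → anc v ≡ us ++ w ∷ zs → Unique (us ++ [ w ])
        tail [] _ = [] ∷ []
        tail (u ∷ us) eq = unique us (sym (proj₁ (unfold eq)))

  module Fundamental {v w : Fin n} (b : BackEdge v w) where
    open BackEdge b

    private
      before after : List (Fin n)
      before = proj₁ (∈-∃++ ancestor)
      after  = proj₁ (proj₂ (∈-∃++ ancestor))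

      parent-eq : anc parent ≡ before ++ w ∷ after
      parent-eq = proj₂ (proj₂ (∈-∃++ ancestor))

      path : anc v ≡ parent ∷ before ++ w ∷ after
      path = trans isParent (cong (parent ∷_) parent-eq)

      long : ∀ us → 3 ≤ length (v ∷ parent ∷ us ++ [ w ])
      long [] = ℕ.≤-refl
      long (_ ∷ us) = ℕ.m≤n⇒m≤1+n (long us)

    steps : All (Step back) (zip (v ∷ parent ∷ before ++ [ w ]) ((parent ∷ before ++ [ w ]) ++ [ v ]))
    steps = all-steps back (parent ∷ before) path

    cycle : Cycle G
    cycle = record
      { start = v ; rest = parent ∷ before ++ [ w ]
      ; length≥3 = long before
      ; distinct = unique back (parent ∷ before) path
      ; adjacent = All.map (step-adj back) steps }

    closing-edge : Cycle.HasEdge cycle w v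
    closing-edge = inj₁ (closing back (parent ∷ before))

    bottom∈ : v ∈ Cycle.vertices cycle
    bottom∈ = here refl

    parent∈C : parent ∈ Cycle.vertices cycle
    parent∈C = there (here refl)

    -- The back edge ends at a proper ancestor of the parent, so the cycle climbs at least one step
    -- beyond the parent. This gives the second common vertex when critical edges meet.
    grandparent∈ : ∀ {y} → Parent parent y → y ∈ Cycle.vertices cycle
    grandparent∈ {y} py = there (there (go before parent-eq))
      where
      go : ∀ us → anc parent ≡ us ++ w ∷ after → y ∈ us ++ [ w ]
      go [] eq = here (∷-injectiveˡ (trans (sym py) eq))
      go (u ∷ us) eq = here (∷-injectiveˡ (trans (sym py) eq))

  -- The closing edge is the only edge of a fundamental cycle that does not join a vertex to its
  -- parent.
  same-cycle : ∀ {v w v′ w′} (b : BackEdge v w) (b′ : BackEdge v′ w′) →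
               SameCycle (Fundamental.cycle b) (Fundamental.cycle b′) → v ≡ v′ × w ≡ w′
  same-cycle {v} {w} {v′} {w′} b b′ same
    with Equivalence.to (same w v) (Fundamental.closing-edge b)
  ... | inj₁ wv∈ = case All.lookup (Fundamental.steps b′) wv∈ of λ where
    (inj₁ wv) → contradiction (parent∈ wv) (anc-asym (BackEdge.back∈ b))
    (inj₂ (w≡w′ , v≡v′)) → v≡v′ , w≡w′
  ... | inj₂ vw∈ = case All.lookup (Fundamental.steps b′) vw∈ of λ where
    (inj₁ vw) → contradiction
      (∷-injectiveˡ (trans (sym vw) (BackEdge.isParent b))) (anc⇒≢ (BackEdge.ancestor b))
    (inj₂ (refl , refl)) → contradiction (BackEdge.back∈ b′) (anc-asym (BackEdge.back∈ b))

  module _ (cactus : IsCactus G) where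

    -- In a cactus two distinct common vertices make the fundamental cycles coincide; `y ∈ anc x`
    -- ensures distinctness.
    common-edge : ∀ {v w v′ w′ x y} (b : BackEdge v w) (b′ : BackEdge v′ w′) →
              x ∈ Cycle.vertices (Fundamental.cycle b) →
              x ∈ Cycle.vertices (Fundamental.cycle b′) →
              y ∈ Cycle.vertices (Fundamental.cycle b) →
              y ∈ Cycle.vertices (Fundamental.cycle b′) →
              y ∈ anc x → v ≡ v′ × w ≡ w′
    common-edge {v} {w} {v′} {w′} {x} {y} b b′ x∈C x∈D y∈C y∈D y∈x
      with (v ≟ v′) ×-dec (w ≟ w′)
    ... | yes same = same
    ... | no differ = contradiction
      (sym (cactus (Fundamental.cycle b) (Fundamental.cycle b′) (differ ∘ same-cycle b b′)
              x y x∈C x∈D y∈C y∈D))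
      (anc⇒≢ y∈x)

    -- Both fundamental cycles contain `v` and its parent.
    unique-back : ∀ {v w w′} → BackEdge v w → BackEdge v w′ → w ≡ w′
    unique-back b b′ with refl ← ∷-injectiveˡ (trans (sym (BackEdge.isParent b)) (BackEdge.isParent b′)) =
      proj₂ (common-edge b b′ (F.bottom∈ b) (F.bottom∈ b′) (F.parent∈C b) (F.parent∈C b′)
               (parent∈ (BackEdge.isParent b)))
      where module F {v} {w} = Fundamental {v} {w}

    -- Two critical edges with a common end yield fundamental cycles with a common tree edge: the
    -- upper critical edge if one lies directly above the other, or the edge from `x` to its own
    -- parent if both end at `x` from below.
    separated-back : ∀ {u w z w′} (b : BackEdge u w) (b′ : BackEdge z w′) →
                     let x = BackEdge.parent b ; x′ = BackEdge.parent b′ in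
                     x′ ≡ u ⊎ x′ ≡ x ⊎ z ≡ x → z ≡ u
    separated-back b b′ (inj₁ refl) = proj₁ (common-edge b′ b
      (F.parent∈C b′) (F.bottom∈ b) (F.grandparent∈ b′ (BackEdge.isParent b)) (F.parent∈C b)
      (parent∈ (BackEdge.isParent b)))
      where module F {v} {w} = Fundamental {v} {w}
    separated-back b b′ (inj₂ (inj₁ refl)) with y , xy ← hasParent (BackEdge.ancestor b) =
      proj₁ (common-edge b′ b (F.parent∈C b′) (F.parent∈C b) (F.grandparent∈ b′ xy) (F.grandparent∈ b xy)
        (parent∈ xy))
      where module F {v} {w} = Fundamental {v} {w}
    separated-back b b′ (inj₂ (inj₂ refl)) = proj₁ (common-edge b′ b
      (F.bottom∈ b′) (F.parent∈C b) (F.parent∈C b′) (F.grandparent∈ b (BackEdge.isParent b′))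
      (parent∈ (BackEdge.isParent b′)))
      where module F {v} {w} = Fundamental {v} {w}

    -- The skeleton of a subgraph that, at every vertex, either retains the edge
    -- to the parent or loses all edges to ancestors.
    module Sub (adj′ : Fin n → Fin n → Bool)
      (adj′-sym : ∀ u v → adj′ u v ≡ adj′ v u)
      (sub : ∀ {u v} → adj′ u v ≡ true → Adj u v)
      (isolated : ∀ {v x} → Parent v x → adj′ v x ≡ false → ∀ {y} → y ∈ anc v → adj′ v y ≡ false)
      where

      data Upper (v : Fin n) : Up n → Set where
        none : (∀ {y} → y ∈ anc v → adj′ v y ≡ false) → Upper v none
        one  : ∀ {x} → Parent v x → adj′ v x ≡ true →
               (∀ {y} → y ∈ anc x → adj′ v y ≡ false) → Upper v (one x)
        two  : ∀ {x w} → Parent v x → adj′ v x ≡ true →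
               w ∈ anc x → adj′ v w ≡ true → Upper v (two x w)

      private
        upper : ∀ v → ∃[ U ] Upper v U
        upper v with shape v
        ... | inj₁ refl = _ , none λ y∈ → case subst (_ ∈_) anc-root y∈ of λ ()
        ... | inj₂ (x , vx , _) with adj′ v x in eq
        ... | false = _ , none (isolated vx eq)
        ... | true with any? (λ w → (w ∈? anc x) ×-dec (adj′ v w ≟ᵇ true))
        ... | yes (w , w∈ , vw) = _ , two vx eq w∈ vw
        ... | no ∄w = _ , one vx eq λ {y} y∈ → ¬-not λ vy → ∄w (y , y∈ , vy)

      up : Fin n → Up n
      up v = proj₁ (upper v)

      up-spec : ∀ v → Upper v (up v)
      up-spec v = proj₂ (upper v)

      backEdge : ∀ {v x w} → Upper v (two x w) → BackEdge v w
      backEdge (two {x} vx _ w∈ vw) = record { parent = x ; isParent = vx ; ancestor = w∈ ; back = sub vw }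

      ∈ᵁ⇒anc : ∀ {v y U} → Upper v U → y ∈ᵁ U → y ∈ anc v
      ∈ᵁ⇒anc (one vx _ _) refl = parent∈ vx
      ∈ᵁ⇒anc (two vx _ _ _) (inj₁ refl) = parent∈ vx
      ∈ᵁ⇒anc (two vx _ w∈ _) (inj₂ refl) = anc-trans w∈ (parent∈ vx)

      private
        spec-two : ∀ {u x w} → up u ≡ two x w → Upper u (two x w)
        spec-two {u} eq = subst (Upper u) eq (up-spec u)

        separated′ : ∀ {u x w z x′ w′} → Upper u (two x w) → Upper z (two x′ w′) →
                    x′ ≡ u ⊎ x′ ≡ x ⊎ z ≡ x → z ≡ u
        separated′ s@(two _ _ _ _) s′@(two _ _ _ _) = separated-back (backEdge s) (backEdge s′)

      skeleton : Skeleton n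
      skeleton = record
        { up = up
        ; depth = depth
        ; up-depth = λ {_} {u} y∈ → anc-depth (∈ᵁ⇒anc (up-spec u) y∈)
        ; two-depth = λ eq → case spec-two eq of λ { (two _ _ w∈ _) → anc-depth w∈ }
        ; separated = λ eq eq′ → separated′ (spec-two eq) (spec-two eq′)
        }

      slot-full : ∀ {u v U} → Upper u U → v ∈ anc u → slot U (2 , 2) v ≡ (if adj′ u v then 2 else 0)
      slot-full (none ∄) v∈ rewrite ∄ v∈ = refl
      slot-full {v = v} (one {x} ux adj ∄) v∈ with x ≟ v | subst (v ∈_) ux v∈
      ... | yes refl | _ rewrite adj = refl
      ... | no x≢v | here v≡x = contradiction (sym v≡x) x≢v
      ... | no x≢v | there v∈x rewrite ∄ v∈x = refl
      slot-full {u} {v} s@(two {x} {w} ux adj w∈ uw) v∈ with x ≟ v | w ≟ v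
      ... | yes refl | yes refl = contradiction refl (anc⇒≢ w∈)
      ... | yes refl | no _ rewrite adj = refl
      ... | no _ | yes refl rewrite uw = refl
      ... | no x≢v | no w≢v with adj′ u v in uv
      ... | false = refl
      ... | true with subst (v ∈_) ux v∈
      ... | here v≡x = contradiction (sym v≡x) x≢v
      ... | there v∈x = contradiction
        (unique-back (backEdge s) (backEdge (two ux adj v∈x uv))) w≢v

      open Labelling skeleton using (red)

      -- Every edge joins a vertex to an ancestor, and by `unique-back` the lower end lists all its
      -- upward edges.
      red-full : ∀ u v → red full u v ≡ (if adj′ u v then 2 else 0)
      red-full u v with v ∈? anc u | u ∈? anc v
      ... | yes v∈ | _ = trans (cong₂ _+_ (slot-full (up-spec u) v∈)
                             (slot-∉ (up v) _ (anc-asym v∈ ∘ ∈ᵁ⇒anc (up-spec v)))) (ℕ.+-identityʳ _)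
      ... | no v∉ | yes u∈ = trans (cong₂ _+_ (slot-∉ (up u) _ (v∉ ∘ ∈ᵁ⇒anc (up-spec u)))
                             (slot-full (up-spec v) u∈)) (cong (if_then 2 else 0) (adj′-sym v u))
      ... | no v∉ | no u∉ = trans (cong₂ _+_ (slot-∉ (up u) _ (v∉ ∘ ∈ᵁ⇒anc (up-spec u)))
                             (slot-∉ (up v) _ (u∉ ∘ ∈ᵁ⇒anc (up-spec v))))
                             (cong (if_then 2 else 0) (sym (¬-not λ uv →
                               [ u∉ , v∉ ]′ (normal u v (sub uv)))))

-- From splittings of multiplicities to colorings.

private
  pattern 0F = zero
  pattern 1F = suc zero

  initial : ∀ {d} → ℕ → Fin d → Fin 2
  initial a i = if toℕ i <ᵇ a then 0F else 1F

  count-initial-0 : ∀ a {b d} → a + b ≡ d → count (_≟ 0F) (tabulate {n = d} (initial a)) ≡ a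
  count-initial-0 zero {zero} refl = refl
  count-initial-0 zero {suc b} refl = count-initial-0 zero {b} refl
  count-initial-0 (suc a) {b} refl = cong suc (count-initial-0 a {b} refl)

  count-initial-1 : ∀ a {b d} → a + b ≡ d → count (_≟ 1F) (tabulate {n = d} (initial a)) ≡ b
  count-initial-1 zero {zero} refl = refl
  count-initial-1 zero {suc b} refl = cong suc (count-initial-1 zero {b} refl)
  count-initial-1 (suc a) {b} refl = count-initial-1 a {b} refl

-- Of the single edges joining `u` and `v`, the first `A u v` get one color and the others the
-- second. As `A` is symmetric and a single edge has the same index in both directions, the colors
-- agree.
colorable-by-matrices : ∀ (M : Multigraph n) (A B : Fin n → Fin n → ℕ) →
  (∀ u v → A u v ≡ A v u) → (∀ u v → A u v + B u v ≡ Multigraph.mult M u v) →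
  (∀ u v → 0 < A u v → sum (A u) ≢ sum (A v)) →
  (∀ u v → 0 < B u v → sum (B u) ≢ sum (B v)) →
  LocallyIrregularColorableWith 2 M
colorable-by-matrices {n = n} M A B A-sym A+B A-irregular B-irregular = φ , irregular
  where
  open Multigraph M

  φ : Coloring M 2
  φ = record
    { color = λ u v → initial (A u v)
    ; symmetric = λ u v i → cong₂ (λ j a → if j <ᵇ a then 0F else 1F)
                              (sym (toℕ-cast (symmetric u v) i)) (A-sym u v)
    }

  transfer : ∀ c (A : Fin n → Fin n → ℕ) →
             (∀ u v → Multigraph.mult (colorClass φ c) u v ≡ A u v) →
             (∀ u v → 0 < A u v → sum (A u) ≢ sum (A v)) → LocallyIrregular (colorClass φ c)
  transfer c A same distinct u v pos degrees = distinct u v (subst (0 <_) (same u v) pos)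
    (trans (sym (sum-cong-≗ (same u))) (trans degrees (sum-cong-≗ (same v))))

  irregular : IsLocallyIrregularColoring φ
  irregular 0F = transfer 0F A (λ u v → count-initial-0 (A u v) (A+B u v)) A-irregular
  irregular 1F = transfer 1F B (λ u v → count-initial-1 (A u v) (A+B u v)) B-irregular

private
  count-Fin1 : ∀ {d} (f : Fin d → Fin 1) → count (_≟ 0F) (tabulate f) ≡ d
  count-Fin1 {zero} f = refl
  count-Fin1 {suc d} f with f zero
  ... | 0F = cong suc (count-Fin1 (f ∘ suc))

-- The exact minimum is decided: 0 without edges, 1 if the multigraph is itself locally irregular,
-- and 2 otherwise.
Lir-≤2 : ∀ (M : Multigraph n) → LocallyIrregularColorableWith 2 M → ∃[ k ] (Lir M k × k ≤ 2)
Lir-≤2 {n = n} M two-colors with any? (λ u → any? (λ v → 0 ℕ.<? Multigraph.mult M u v))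
... | no edgeless = 0 , ((φ , λ ()) , λ _ _ → z≤n) , z≤n
  where
  open Multigraph M
  absurd : ∀ {A : Set} u v → Fin (mult u v) → A
  absurd u v i = contradiction (u , v , ℕ.≤-<-trans z≤n (toℕ<n i)) edgeless
  φ : Coloring M 0
  φ = record { color = λ u v i → absurd u v i ; symmetric = λ u v i → absurd u v i }
... | yes (u₀ , v₀ , edge) = by-regularity
    (all? λ u → all? λ v → (0 ℕ.<? mult u v) →-dec ¬? (degree u ℕ.≟ degree v))
  where
  open Multigraph M
  one-class : (φ : Coloring M 1) → ∀ u v → Multigraph.mult (colorClass φ 0F) u v ≡ mult u v
  one-class φ u v = count-Fin1 (Coloring.color φ u v)

  φ₁ : Coloring M 1
  φ₁ = record { color = λ _ _ _ → 0F ; symmetric = λ _ _ _ → refl }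

  positive : ∀ j → LocallyIrregularColorableWith j M → 1 ≤ j
  positive zero (φ , _) = case Coloring.color φ u₀ v₀ (fromℕ< edge) of λ ()
  positive (suc j) _ = s≤s z≤n

  by-regularity : Dec (LocallyIrregular M) → ∃[ k ] (Lir M k × k ≤ 2)
  by-regularity (yes irregular) = 1 , ((φ₁ , irregular₁) , positive) , s≤s z≤n
    where
    irregular₁ : IsLocallyIrregularColoring φ₁
    irregular₁ 0F u v pos degrees = irregular u v (subst (0 <_) (one-class φ₁ u v) pos)
      (trans (sym (sum-cong-≗ (one-class φ₁ u))) (trans degrees (sum-cong-≗ (one-class φ₁ v))))
  by-regularity (no regular) = 2 , (two-colors , at-least-2) , ℕ.≤-refl
    where
    at-least-2 : ∀ j → LocallyIrregularColorableWith j M → 2 ≤ j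
    at-least-2 zero colorable = contradiction (positive zero colorable) λ ()
    at-least-2 1 (φ , irregular) = contradiction
      (λ u v pos degrees → irregular 0F u v (subst (0 <_) (sym (one-class φ u v)) pos)
        (trans (sum-cong-≗ (one-class φ u)) (trans degrees (sym (sum-cong-≗ (one-class φ v))))))
      regular
    at-least-2 (suc (suc _)) _ = s≤s (s≤s z≤n)

-- Edges made irregular by parity or by compatibility.

bit : Parity → ℕ
bit 0ℙ = 0
bit 1ℙ = 1

parity-bit : ∀ p → parity (bit p) ≡ p
parity-bit 0ℙ = refl
parity-bit 1ℙ = refl

module _ (S : Skeleton n) where
  open Skeleton S
  open Labelling S

  -- Of an alternating parity function and its opposite one has an even sum over
  -- any set of odd size; μ is the characteristic function of this set.
  even-alternating : ∀ (μ : Fin n → ℕ) → parity (sum μ) ≡ 1ℙ →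
    ∃[ p ] ((∀ v → Alternating p v) × parity (sum (λ v → μ v * bit (p v))) ≡ 0ℙ)
  even-alternating μ odd with p , alt ← alternating
    with parity (sum (λ v → μ v * bit (p v))) in eq
  ... | 0ℙ = p , alt , eq
  ... | 1ℙ = _⁻¹ ∘ p , (λ v → (λ x e → cong _⁻¹ (proj₁ (alt v) x e)) ,
                             (λ x w e → cong _⁻¹ (proj₂ (alt v) x w e))) ,
    -- The weighted sums for `p` and its opposite add up to the odd number `sum μ`; as the first is
    -- odd, the second is even.
    ℙ.+-cancelˡ-≡ 1ℙ _ _ (begin
      1ℙ ℙ.+ parity (sum (λ v → μ v * bit (p v ⁻¹)))
        ≡⟨ cong (ℙ._+ parity (sum (λ v → μ v * bit (p v ⁻¹)))) eq ⟨
      parity (sum (λ v → μ v * bit (p v))) ℙ.+ parity (sum (λ v → μ v * bit (p v ⁻¹)))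
        ≡⟨ ℙ.+-homo-+ (sum (λ v → μ v * bit (p v))) _ ⟨
      parity (sum (λ v → μ v * bit (p v)) + sum (λ v → μ v * bit (p v ⁻¹)))
        ≡⟨ cong parity (∑-distrib-+ (λ v → μ v * bit (p v)) _) ⟨
      parity (sum (λ v → μ v * bit (p v) + μ v * bit (p v ⁻¹)))
        ≡⟨ cong parity (sum-cong-≗ (λ v → both (μ v) (p v))) ⟩
      parity (sum μ) ≡⟨ odd ⟩
      1ℙ ∎)
    where
    open ≡-Reasoning
    both : ∀ m p → m * bit p + m * bit (p ⁻¹) ≡ m
    both m 0ℙ = trans (cong₂ _+_ (ℕ.*-zeroʳ m) (ℕ.*-identityʳ m)) refl
    both m 1ℙ = trans (cong₂ _+_ (ℕ.*-identityʳ m) (ℕ.*-zeroʳ m)) (ℕ.+-identityʳ m)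

  module _ (g : Labels n) where
    open Core S using (Compatible)

    Safe : Fin n → Fin n → Set
    Safe u v = parity (Red g u) ≢ parity (Red g v)
             ⊎ (∃[ w ] up u ≡ two v w) ⊎ (∃[ w ] up v ≡ two u w)

    red-two : ∀ h {u x w} → up u ≡ two x w → red h u x ≡ proj₁ (h u)
    red-two h {u} {x} {w} eq = trans (cong₂ _+_
      (trans (cong (λ U → slot U (h u) x) eq)
        (trans (cong₂ _+_ (single-≡ {x = x} (proj₁ (h u)) refl)
                          (single-≢ {x = w} (proj₂ (h u)) λ { refl → ℕ.<-irrefl refl (two-depth eq) }))
               (ℕ.+-identityʳ _)))
      (slot-∉ (up x) (h x) λ u∈ → ℕ.<-asym (up-depth u∈) (up-depth (subst (x ∈ᵁ_) (sym eq) (inj₁ refl)))))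
      (ℕ.+-identityʳ _)

    module _ (bounded : Bounded g) (compatible : ∀ u x w → up u ≡ two x w → Compatible g u x)
      (τ τ′ : Fin n → ℕ) (τ-even : ∀ v → parity (τ v) ≡ 0ℙ) (τ′-even : ∀ v → parity (τ′ v) ≡ 0ℙ)
      (off : ∀ {u x w} → up u ≡ two x w → τ u ≡ τ x × τ′ u ≡ τ′ x) where

      private
        +-even : ∀ m {t} → parity t ≡ 0ℙ → parity (m + t) ≡ parity m
        +-even m {t} even = trans (ℙ.+-homo-+ m t) (trans (cong (parity m ℙ.+_) even) (ℙ.+-identityʳ _))

        cancel : ∀ {a b s t} → s ≡ t → a + s ≡ b + t → a ≡ b
        cancel refl eq = ℕ.+-cancelʳ-≡ _ _ _ eq

        small : ∀ {a} → 0 < 2 ∸ a → a < 2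
        small {zero} _ = s≤s z≤n
        small {suc zero} _ = ℕ.≤-refl
        small {suc (suc a)} pos = contradiction (subst (0 <_) (ℕ.0∸n≡0 a) pos) λ ()

      -- `τ` and `τ′` stand for the red and blue degrees contributed by a vertex added later. Being
      -- even, they preserve parities; being equal at both ends of a critical edge, they cancel
      -- there.
      safe-red : ∀ {u v} → Safe u v → 0 < red g u v → Red g u + τ u ≢ Red g v + τ v
      safe-red {u} {v} (inj₁ parities) _ eq = parities
        (trans (sym (+-even (Red g u) (τ-even u))) (trans (cong parity eq) (+-even (Red g v) (τ-even v))))
      safe-red {u} {v} (inj₂ (inj₁ (w , e))) pos eq =
        proj₁ (compatible u v w e) (subst (0 <_) (red-two g e) pos) (cancel (proj₁ (off e)) eq)
      safe-red {u} {v} (inj₂ (inj₂ (w , e))) pos eq =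
        proj₁ (compatible v u w e) (subst (0 <_) (trans (red-sym g u v) (red-two g e)) pos)
          (cancel (proj₁ (off e)) (sym eq))

      safe-blue : ∀ {u v} → Safe u v → 0 < red (complement g) u v → Blue g u + τ′ u ≢ Blue g v + τ′ v
      safe-blue {u} {v} (inj₁ parities) _ eq = parities
        (trans (parity-Blue bounded u) (trans (sym (+-even (Blue g u) (τ′-even u)))
          (trans (cong parity eq) (trans (+-even (Blue g v) (τ′-even v)) (sym (parity-Blue bounded v))))))
      safe-blue {u} {v} (inj₂ (inj₁ (w , e))) pos eq =
        proj₂ (compatible u v w e) (small (subst (0 <_) (red-two (complement g) e) pos))
          (cancel (proj₂ (off e)) eq)
      safe-blue {u} {v} (inj₂ (inj₂ (w , e))) pos eq =
        proj₂ (compatible v u w e)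
          (small (subst (0 <_) (trans (red-sym (complement g) u v) (red-two (complement g) e)) pos))
          (cancel (proj₂ (off e)) (sym eq))

module _ (S : Skeleton n) where
  open Skeleton S
  open Labelling S

  _↑_ : Fin n → Fin n → Set
  u ↑ v = up u ≡ one v ⊎ (∃[ w ] up u ≡ two v w) ⊎ (∃[ x ] up u ≡ two x v)

  -- Among upward edges only the first of two escapes alternation, and that one is critical.
  edge-safe : ∀ p g {u v} → (∀ v → Alternating p v) →
              parity (Red g u) ≡ p u → parity (Red g v) ≡ p v →
              u ↑ v ⊎ v ↑ u → Safe S g u v
  edge-safe p g {u} {v} alt pu pv = λ where
      (inj₁ (inj₁ e)) → inj₁ λ eq → opposite (proj₁ (alt u) v e) eq
      (inj₁ (inj₂ (inj₁ e))) → inj₂ (inj₁ e)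
      (inj₁ (inj₂ (inj₂ (x , e)))) → inj₁ λ eq → opposite (proj₂ (alt u) x v e) eq
      (inj₂ (inj₁ e)) → inj₁ λ eq → opposite′ (proj₁ (alt v) u e) eq
      (inj₂ (inj₂ (inj₁ e))) → inj₂ (inj₂ e)
      (inj₂ (inj₂ (inj₂ (x , e)))) → inj₁ λ eq → opposite′ (proj₂ (alt v) x u e) eq
    where
    opposite : p u ≡ p v ⁻¹ → parity (Red g u) ≢ parity (Red g v)
    opposite alt eq = ⁻¹⇒≢ alt (trans (sym pu) (trans eq pv))
    opposite′ : p v ≡ p u ⁻¹ → parity (Red g u) ≢ parity (Red g v)
    opposite′ alt eq = ⁻¹⇒≢ alt (trans (sym pv) (trans (sym eq) pu))

  record Spans (adj′ : Fin n → Fin n → Bool) : Set where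
    field
      edges     : ∀ {u v} → adj′ u v ≡ true → u ↑ v ⊎ v ↑ u
      red-full  : ∀ u v → red full u v ≡ (if adj′ u v then 2 else 0)

    red⇒adj : ∀ {u v a b} → 0 < a → a + b ≡ red full u v → adj′ u v ≡ true
    red⇒adj {u} {v} pos eq = ¬-not λ non-adj → contradiction
      (ℕ.<-≤-trans pos (ℕ.m+n≤o⇒m≤o _ (ℕ.≤-reflexive
        (trans eq (trans (red-full u v) (cong (if_then 2 else 0) non-adj)))))) λ ()

-- Graphs of odd order.

module _ (G : Graph n) (S : Skeleton n) (spans : Spans S (Graph.adj G)) {root : Fin n}
  (only-root : ∀ {v} → Skeleton.up S v ≡ none → v ≡ root) (odd : parity n ≡ 1ℙ) where
  open Labelling S
  open Core S
  open Spans spans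

  odd-colorable : LocallyIrregularColorableWith 2 (² G)
  odd-colorable = from-parities (even-alternating S (const 1) (trans (cong parity (sum-ones n)) odd))
    where
    unit : ∀ q → parity (1 * bit q) ≡ q
    unit q = trans (cong parity (ℕ.*-identityˡ (bit q))) (parity-bit q)

    module _ (p : Fin n → Parity) (alt : ∀ v → Alternating p v)
      (even : parity (sum (λ v → 1 * bit (p v))) ≡ 0ℙ)
      (solution : Solution p) where
      open Solution solution

      other : ∀ v → v ≢ root → parity (Red g v) ≡ p v
      other v v≢root = g-parity v (v≢root ∘ only-root)

      parities : ∀ v → parity (Red g v) ≡ p v
      parities v with v ≟ root
      ... | no v≢root = other v v≢root
      -- No upward edge can correct the root; the even sum of the prescribed parities and the
      -- handshake argument settle it.
      ... | yes refl = trans (parity-remaining {F = Red g} {G = λ v → 1 * bit (p v)} root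
                               (λ v v≢ → trans (other v v≢) (sym (unit (p v))))
                               (trans (handshake g) (sym even))) (unit (p v))

      split : ∀ u v → red g u v + red (complement g) u v ≡ red full u v
      split = red-complement g-bounded

      safe : ∀ {u v a b} → 0 < a → a + b ≡ red full u v → Safe S g u v
      safe {u} {v} pos eq = edge-safe S p g {u} {v} alt (parities u) (parities v) (edges {u} {v} (red⇒adj {u} {v} pos eq))

      zero-even : ∀ (v : Fin n) → parity 0 ≡ 0ℙ
      zero-even _ = refl

      colouring : LocallyIrregularColorableWith 2 (² G)
      colouring = colorable-by-matrices (² G) (red g) (red (complement g)) (red-sym g)
        (λ u v → trans (split u v) (red-full u v))
        (λ u v pos eq → safe-red S g g-bounded compatible (const 0) (const 0) zero-even zero-even
          (λ _ → refl , refl) {u} {v} (safe {u} {v} pos (split u v)) pos (cong (_+ 0) eq))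
        (λ u v pos eq → safe-blue S g g-bounded compatible (const 0) (const 0) zero-even zero-even
          (λ _ → refl , refl) {u} {v}
          (safe {u} {v} pos (trans (ℕ.+-comm _ (red g u v)) (split u v))) pos (cong (_+ 0) eq))

    from-parities : ∃[ p ] ((∀ v → Alternating p v) × parity (sum (λ v → 1 * bit (p v))) ≡ 0ℙ) →
                    LocallyIrregularColorableWith 2 (² G)
    from-parities (p , alt , even) = colouring p alt even (solve p)

-- Removing a vertex and coloring its edges afterwards.

removeVertex : Graph n → Fin n → Fin n → Fin n → Bool
removeVertex G ρ u v = not (does (u ≟ ρ)) ∧ not (does (v ≟ ρ)) ∧ Graph.adj G u v

module _ (G : Graph n) (ρ : Fin n) where
  open Graph G

  removeVertex-elim : ∀ u v → removeVertex G ρ u v ≡ true → u ≢ ρ × v ≢ ρ × adj u v ≡ true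
  removeVertex-elim u v uv with u ≟ ρ | v ≟ ρ
  ... | no u≢ρ | no v≢ρ = u≢ρ , v≢ρ , uv

  removeVertex-other : ∀ {u v} → u ≢ ρ → v ≢ ρ → removeVertex G ρ u v ≡ adj u v
  removeVertex-other {u} {v} u≢ρ v≢ρ with u ≟ ρ | v ≟ ρ
  ... | yes u≡ρ | _ = contradiction u≡ρ u≢ρ
  ... | no _ | yes v≡ρ = contradiction v≡ρ v≢ρ
  ... | no _ | no _ = refl

  removeVertex-at : ∀ v → removeVertex G ρ ρ v ≡ false
  removeVertex-at v = ¬-not λ eq → proj₁ (removeVertex-elim ρ v eq) refl

  removeVertex-sym : ∀ u v → removeVertex G ρ u v ≡ removeVertex G ρ v u
  removeVertex-sym u v with u ≟ ρ | v ≟ ρ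
  ... | yes _ | yes _ = refl
  ... | yes _ | no _ = refl
  ... | no _ | yes _ = refl
  ... | no _ | no _ = symmetric u v

-- The symmetric matrix with `τ` in row and column `ρ`. It is meant for `τ ρ ≡ 0`, since the
-- diagonal entry at `ρ` is counted twice.
star : Fin n → (Fin n → ℕ) → Fin n → Fin n → ℕ
star ρ τ u v = single ρ u (τ v) + single ρ v (τ u)

withStar : Fin n → (Fin n → ℕ) → (Fin n → Fin n → ℕ) → Fin n → Fin n → ℕ
withStar ρ τ A u v = A u v + star ρ τ u v

module _ (ρ : Fin n) (τ : Fin n → ℕ) where

  star-sym : ∀ u v → star ρ τ u v ≡ star ρ τ v u
  star-sym u v = ℕ.+-comm (single ρ u (τ v)) _

  star-other : ∀ {u v} → u ≢ ρ → v ≢ ρ → star ρ τ u v ≡ 0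
  star-other u≢ρ v≢ρ = cong₂ _+_ (single-≢ _ (≢-sym u≢ρ)) (single-≢ _ (≢-sym v≢ρ))

  star-centre : τ ρ ≡ 0 → ∀ v → star ρ τ ρ v ≡ τ v
  star-centre τρ v = trans (cong₂ _+_ (single-≡ {x = ρ} (τ v) refl) at-centre) (ℕ.+-identityʳ (τ v))
    where
    at-centre : single ρ v (τ ρ) ≡ 0
    at-centre with ρ ≟ v
    ... | yes _ = τρ
    ... | no _ = refl

  sum-star-other : ∀ {v} → v ≢ ρ → sum (star ρ τ v) ≡ τ v
  sum-star-other {v} v≢ρ = trans (sum-cong-≗ λ u → cong (_+ single ρ u (τ v)) (single-≢ (τ u) (≢-sym v≢ρ)))
    (sum-single ρ (τ v))

  withStar-sym : ∀ A → (∀ u v → A u v ≡ A v u) → ∀ u v → withStar ρ τ A u v ≡ withStar ρ τ A v u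
  withStar-sym A A-sym u v = cong₂ _+_ (A-sym u v) (star-sym u v)

  module _ (A : Fin n → Fin n → ℕ) (A-sym : ∀ u v → A u v ≡ A v u)
    (A-centre : ∀ v → A ρ v ≡ 0) (τρ : τ ρ ≡ 0)
    (centre : ∀ v → v ≢ ρ → 0 < τ v → sum τ ≢ sum (A v) + τ v)
    (other : ∀ u v → u ≢ ρ → v ≢ ρ → 0 < A u v → sum (A u) + τ u ≢ sum (A v) + τ v)
    where

    private
      A⁺ : Fin n → Fin n → ℕ
      A⁺ = withStar ρ τ A

      withStar-centre : ∀ v → A⁺ ρ v ≡ τ v
      withStar-centre v = cong₂ _+_ (A-centre v) (star-centre τρ v)

      sum-centre : sum (A⁺ ρ) ≡ sum τ
      sum-centre = sum-cong-≗ withStar-centre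

      sum-other : ∀ {v} → v ≢ ρ → sum (A⁺ v) ≡ sum (A v) + τ v
      sum-other {v} v≢ρ = trans (∑-distrib-+ (A v) (star ρ τ v)) (cong (sum (A v) +_) (sum-star-other v≢ρ))

    withStar-irregular : ∀ u v → 0 < A⁺ u v → sum (A⁺ u) ≢ sum (A⁺ v)
    withStar-irregular u v pos eq with u ≟ ρ | v ≟ ρ
    ... | yes refl | yes refl = contradiction (subst (0 <_) (trans (withStar-centre ρ) τρ) pos) λ ()
    ... | yes refl | no v≢ρ = centre v v≢ρ (subst (0 <_) (withStar-centre v) pos)
      (trans (sym sum-centre) (trans eq (sum-other v≢ρ)))
    ... | no u≢ρ | yes refl = centre u u≢ρ
      (subst (0 <_) (trans (withStar-sym A A-sym u ρ) (withStar-centre u)) pos)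
      (trans (sym sum-centre) (trans (sym eq) (sum-other u≢ρ)))
    ... | no u≢ρ | no v≢ρ = other u v u≢ρ v≢ρ
      (subst (0 <_) (trans (cong (A u v +_) (star-other u≢ρ v≢ρ)) (ℕ.+-identityʳ (A u v))) pos)
      (trans (sym (sum-other u≢ρ)) (trans eq (sum-other v≢ρ)))

OneOrTwo : (Fin n → ℕ) → Set
OneOrTwo {n} d = (∃[ a ] (∀ v → d v ≡ single a v 2))
               ⊎ (∃[ a ] ∃[ b ] (a ≢ b × (∀ v → d v ≡ single a v 2 + single b v 2)))

-- `d` lists the multiplicities at the removed vertex, `R` and `B` the degrees attained before it
-- returns; its own degrees become `sum τ` and `sum τ′`.
record StarColouring (d R B : Fin n → ℕ) : Set where
  field
    τ τ′    : Fin n → ℕ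
    split   : ∀ v → τ v + τ′ v ≡ d v
    τ-even  : ∀ v → parity (τ v) ≡ 0ℙ
    τ′-even : ∀ v → parity (τ′ v) ≡ 0ℙ
    red-ok  : ∀ v → 0 < τ v → sum τ ≢ R v + τ v
    blue-ok : ∀ v → 0 < τ′ v → sum τ′ ≢ B v + τ′ v

module _ {d R B : Fin n → ℕ} (nonisolated : ∀ v → 0 < d v → 0 < R v + B v) where

  private
    solid-split : ∀ c → solid c + solid (not c) ≡ 2
    solid-split true = refl
    solid-split false = refl

    other-positive : ∀ {r b} → 0 < r + b → r ≡ 0 → b ≢ 0
    other-positive pos refl refl = ℕ.<-irrefl refl pos

  -- Both copies get a color already present at `a`, whose degree in it then exceeds the degree 2 of
  -- the removed vertex.
  one-neighbour : ∀ a → (∀ v → d v ≡ single a v 2) → StarColouring d R B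
  one-neighbour a d≡ = choose (R a ℕ.≟ 0)
    where
    pos-a : 0 < R a + B a
    pos-a = nonisolated a (subst (0 <_) (sym (trans (d≡ a) (single-≡ {x = a} 2 refl))) (s≤s z≤n))

    ok : ∀ (X : Fin n → ℕ) c → (c ≡ true → X a ≢ 0) → ∀ v → 0 < single a v (solid c) →
         sum (λ v → single a v (solid c)) ≢ X v + single a v (solid c)
    ok X c Xa v pos eq with a ≟ v
    ok X false Xa v () eq | yes refl
    ok X true Xa v pos eq | yes refl = Xa refl (ℕ.+-cancelʳ-≡ 2 _ _ (trans (sym eq) (sum-single a 2)))

    build : ∀ c → (c ≡ true → R a ≢ 0) → (not c ≡ true → B a ≢ 0) → StarColouring d R B
    build c Ra Ba = record
      { τ = λ v → single a v (solid c) ; τ′ = λ v → single a v (solid (not c))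
      ; split = λ v → trans (single-+ a v (solid c) _) (trans (cong (single a v) (solid-split c)) (sym (d≡ v)))
      ; τ-even = λ v → parity-single-solid a v c ; τ′-even = λ v → parity-single-solid a v (not c)
      ; red-ok = ok R c Ra ; blue-ok = ok B (not c) Ba }

    choose : Dec (R a ≡ 0) → StarColouring d R B
    choose (yes Ra≡0) = build false (λ ()) (λ _ → other-positive pos-a Ra≡0)
    choose (no Ra≢0) = build true (λ _ → Ra≢0) (λ ())

  -- If some colour is present at a and the other one at b, use these for ρa and
  -- ρb; otherwise a and b see one and the same colour, so use the other one for
  -- both edges.
  two-neighbours : ∀ a b → a ≢ b → (∀ v → d v ≡ single a v 2 + single b v 2) → StarColouring d R B
  two-neighbours a b a≢b d≡ = choose (R a ℕ.≟ 0) (B a ℕ.≟ 0) (R b ℕ.≟ 0) (B b ℕ.≟ 0)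
    where
    pos-a : 0 < R a + B a
    pos-a = nonisolated a (subst (0 <_)
      (sym (trans (d≡ a) (cong (_+ single b a 2) (single-≡ {x = a} 2 refl)))) (s≤s z≤n))

    pos-b : 0 < R b + B b
    pos-b = nonisolated b (subst (0 <_)
      (sym (trans (d≡ b) (cong₂ _+_ (single-≢ 2 a≢b) (single-≡ {x = b} 2 refl)))) (s≤s z≤n))

    T₂ : Bool → Bool → Fin n → ℕ
    T₂ c e v = single a v (solid c) + single b v (solid e)

    sum-T₂ : ∀ c e → sum (T₂ c e) ≡ solid c + solid e
    sum-T₂ c e = trans (∑-distrib-+ (λ v → single a v (solid c)) (λ v → single b v (solid e)))
                       (cong₂ _+_ (sum-single a (solid c)) (sum-single b (solid e)))

    -- Cancelling the 2 on the edge to `a` leaves a comparison of `X a` with the label on the edge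
    -- to `b`, and vice versa.
    ok : ∀ (X : Fin n → ℕ) c e → (c ≡ true → X a ≢ solid e) → (e ≡ true → X b ≢ solid c) →
         ∀ v → 0 < T₂ c e v → sum (T₂ c e) ≢ X v + T₂ c e v
    ok X c e Xa Xb v pos eq with a ≟ v | b ≟ v | trans (sym (sum-T₂ c e)) eq
    ok X c e Xa Xb v pos eq | yes refl | yes refl | _ = a≢b refl
    ok X true e Xa Xb v pos eq | yes refl | no _ | eq′ =
      Xa refl (sym (ℕ.+-cancelʳ-≡ 2 _ _ (trans (ℕ.+-comm (solid e) 2) eq′)))
    ok X c true Xa Xb v pos eq | no _ | yes refl | eq′ =
      Xb refl (sym (ℕ.+-cancelʳ-≡ 2 _ _ eq′))

    build : ∀ c e → (c ≡ true → R a ≢ solid e) → (e ≡ true → R b ≢ solid c) →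
            (not c ≡ true → B a ≢ solid (not e)) → (not e ≡ true → B b ≢ solid (not c)) → StarColouring d R B
    build c e Ra Rb Ba Bb = record
      { τ = T₂ c e ; τ′ = T₂ (not c) (not e)
      ; split = λ v → trans (slot-+ (two a b) (solid c) (solid e) (solid (not c)) (solid (not e)) v)
          (trans (cong₂ (λ i j → single a v i + single b v j) (solid-split c) (solid-split e)) (sym (d≡ v)))
      ; τ-even = λ v → parity-+-even (single a v (solid c)) _
                         (parity-single-solid a v c) (parity-single-solid b v e)
      ; τ′-even = λ v → parity-+-even (single a v (solid (not c))) _
                          (parity-single-solid a v (not c)) (parity-single-solid b v (not e))
      ; red-ok = ok R c e Ra Rb ; blue-ok = ok B (not c) (not e) Ba Bb }

    ≢2 : ∀ {m} → m ≡ 0 → m ≢ 2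
    ≢2 refl ()

    choose : Dec (R a ≡ 0) → Dec (B a ≡ 0) → Dec (R b ≡ 0) → Dec (B b ≡ 0) → StarColouring d R B
    choose (no Ra) _ _ (no Bb) = build true false (λ _ → Ra) (λ ()) (λ ()) (λ _ → Bb)
    choose _ (no Ba) (no Rb) _ = build false true (λ ()) (λ _ → Rb) (λ _ → Ba) (λ ())
    choose (yes Ra) _ (yes Rb) _ = build true true (λ _ → ≢2 Ra) (λ _ → ≢2 Rb) (λ ()) (λ ())
    choose _ (yes Ba) _ (yes Bb) = build false false (λ ()) (λ ()) (λ _ → ≢2 Ba) (λ _ → ≢2 Bb)
    choose (yes Ra) (yes Ba) (no _) (no _) = contradiction Ba (other-positive pos-a Ra)
    choose (no _) (no _) (yes Rb) (yes Bb) = contradiction Bb (other-positive pos-b Rb)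

  starColouring : OneOrTwo d → StarColouring d R B
  starColouring (inj₁ (a , d≡)) = one-neighbour a d≡
  starColouring (inj₂ (a , b , a≢b , d≡)) = two-neighbours a b a≢b d≡

module _ (G : Graph n) (S : Skeleton n) (ρ : Fin n) (spans : Spans S (removeVertex G ρ)) where
  open Graph G
  open Multigraph (² G) using (mult) renaming (loopless to mult-loopless)
  open Skeleton S
  open Labelling S
  open Core S
  open Spans spans

  module _ {r : Fin n}
    (only : ∀ {v} → up v ≡ none → v ≢ ρ → v ≡ r)
    (away : ∀ {u x w} → up u ≡ two x w → adj ρ u ≡ false × adj ρ x ≡ false)
    (nonisolated : ∀ {v} → adj ρ v ≡ true → ∃[ u ] removeVertex G ρ v u ≡ true)
    (neighbours : OneOrTwo (mult ρ))
    (even : parity n ≡ 0ℙ) where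

    private
      -- The set of odd size for `even-alternating` consists of all vertices but `ρ`.
      μ : Fin n → ℕ
      μ v = 1 ∸ single ρ v 1

      μ-centre : μ ρ ≡ 0
      μ-centre = cong (1 ∸_) (single-≡ {x = ρ} 1 refl)

      μ-other : ∀ {v} → v ≢ ρ → μ v ≡ 1
      μ-other v≢ρ = cong (1 ∸_) (single-≢ 1 (≢-sym v≢ρ))

      μ-odd : parity (sum μ) ≡ 1ℙ
      μ-odd = ℙ.+-cancelʳ-≡ 1ℙ _ _ (begin
        parity (sum μ) ℙ.+ 1ℙ      ≡⟨ ℙ.+-homo-+ (sum μ) 1 ⟨
        parity (sum μ + 1)         ≡⟨ cong parity (sum-bump ρ 1 (cong (_+ 1) (sym μ-centre))
                                        (λ u u≢ρ → sym (μ-other u≢ρ))) ⟨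
        parity (sum {n} (λ _ → 1)) ≡⟨ cong parity (sum-ones n) ⟩
        parity n                   ≡⟨ even ⟩
        0ℙ                         ∎)
        where open ≡-Reasoning

      mult-positive : ∀ {v} → 0 < mult ρ v → adj ρ v ≡ true
      mult-positive {v} pos with adj ρ v
      ... | true = refl

      full-positive : ∀ v → 0 < mult ρ v → 0 < Red full v
      full-positive v pos with u , vu ← nonisolated (mult-positive pos) =
        ℕ.<-≤-trans (subst (0 <_) (sym (trans (red-full v u) (cong (if_then 2 else 0) vu))) (s≤s z≤n))
          (term≤sum (red full v) u)

      module _ (p : Fin n → Parity) (alt : ∀ v → Alternating p v)
        (even-sum : parity (sum (λ v → μ v * bit (p v))) ≡ 0ℙ)
        (solution : Solution p) where
        open Solution solution

        split-red : ∀ u v → red g u v + red (complement g) u v ≡ red full u v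
        split-red = red-complement g-bounded

        centre-zero : ∀ v → red g ρ v + red (complement g) ρ v ≡ 0
        centre-zero v = trans (split-red ρ v)
          (trans (red-full ρ v) (cong (if_then 2 else 0) (removeVertex-at G ρ v)))

        red-centre : ∀ v → red g ρ v ≡ 0
        red-centre v = ℕ.m+n≡0⇒m≡0 _ (centre-zero v)

        blue-centre : ∀ v → red (complement g) ρ v ≡ 0
        blue-centre v = ℕ.m+n≡0⇒n≡0 (red g ρ v) (centre-zero v)

        weight : Fin n → ℕ
        weight v = μ v * bit (p v)

        weight-other : ∀ {v} → v ≢ ρ → parity (weight v) ≡ p v
        weight-other {v} v≢ρ = trans (cong parity (trans (cong (_* bit (p v)) (μ-other v≢ρ)) (ℕ.*-identityˡ _)))
          (parity-bit (p v))

        before-r : ∀ v → v ≢ r → parity (Red g v) ≡ parity (weight v)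
        before-r v v≢r with v ≟ ρ
        ... | yes refl = trans (parity-sum-even {F = red g ρ} (λ u → cong parity (red-centre u)))
          (sym (cong (λ m → parity (m * bit (p ρ))) μ-centre))
        ... | no v≢ρ = trans (g-parity v (λ e → v≢r (only e v≢ρ))) (sym (weight-other v≢ρ))

        parities : ∀ {v} → v ≢ ρ → parity (Red g v) ≡ p v
        parities {v} v≢ρ = trans (at (v ≟ r)) (weight-other v≢ρ)
          where
          at : Dec (v ≡ r) → parity (Red g v) ≡ parity (weight v)
          at (no v≢r) = before-r v v≢r
          -- `r` is the only vertex besides `ρ` without upward edges, and `ρ` contributes 0 to both
          -- sums.
          at (yes refl) = parity-remaining {F = Red g} {G = weight} r before-r (trans (handshake g) (sym even-sum))

        safe : ∀ u v → u ≢ ρ → v ≢ ρ → ∀ {a b} → 0 < a → a + b ≡ red full u v → Safe S g u v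
        safe u v u≢ρ v≢ρ pos eq = edge-safe S p g {u} {v} alt (parities u≢ρ) (parities v≢ρ)
          (edges {u} {v} (red⇒adj {u} {v} pos eq))

        module _ (colouring : StarColouring (mult ρ) (Red g) (Blue g)) where
          open StarColouring colouring

          outside : ∀ {v} → mult ρ v ≡ 0 → τ v ≡ 0 × τ′ v ≡ 0
          outside {v} d≡0 = ℕ.m+n≡0⇒m≡0 _ (trans (split v) d≡0) , ℕ.m+n≡0⇒n≡0 (τ v) (trans (split v) d≡0)

          τρ : τ ρ ≡ 0 × τ′ ρ ≡ 0
          τρ = outside (mult-loopless ρ)

          -- No end of a critical edge is a neighbour of `ρ`, so the star adds nothing at either
          -- end.
          off : ∀ {u x w} → up u ≡ two x w → τ u ≡ τ x × τ′ u ≡ τ′ x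
          off {u} {x} e =
            let zu , zu′ = outside (cong (if_then 2 else 0) (proj₁ (away e)))
                zx , zx′ = outside (cong (if_then 2 else 0) (proj₂ (away e)))
            in trans zu (sym zx) , trans zu′ (sym zx′)

          star-split : ∀ u v → star ρ τ u v + star ρ τ′ u v ≡ star ρ (mult ρ) u v
          star-split u v = trans (interchange (single ρ u (τ v)) (single ρ v (τ u)) _ _)
            (cong₂ _+_ (trans (single-+ ρ u (τ v) _) (cong (single ρ u) (split v)))
                       (trans (single-+ ρ v (τ u) _) (cong (single ρ v) (split u))))

          reassemble : ∀ u v → red full u v + star ρ (mult ρ) u v ≡ mult u v
          reassemble u v = cases (u ≟ ρ) (v ≟ ρ)
            where
            at-centre : ∀ v → red full ρ v + star ρ (mult ρ) ρ v ≡ mult ρ v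
            at-centre v = cong₂ _+_ (trans (red-full ρ v) (cong (if_then 2 else 0) (removeVertex-at G ρ v)))
                                    (star-centre ρ (mult ρ) (mult-loopless ρ) v)
            cases : Dec (u ≡ ρ) → Dec (v ≡ ρ) → red full u v + star ρ (mult ρ) u v ≡ mult u v
            cases (yes refl) _ = at-centre v
            cases (no _) (yes refl) = trans (cong₂ _+_ (red-sym full u ρ) (star-sym ρ (mult ρ) u ρ))
              (trans (at-centre u) (Multigraph.symmetric (² G) ρ u))
            cases (no u≢ρ) (no v≢ρ) = trans (cong₂ _+_
              (trans (red-full u v) (cong (if_then 2 else 0) (removeVertex-other G ρ u≢ρ v≢ρ)))
              (star-other ρ (mult ρ) u≢ρ v≢ρ)) (ℕ.+-identityʳ _)

          with-star : LocallyIrregularColorableWith 2 (² G)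
          with-star = colorable-by-matrices (² G) (withStar ρ τ (red g)) (withStar ρ τ′ (red (complement g)))
            (withStar-sym ρ τ (red g) (red-sym g))
            (λ u v → trans (interchange (red g u v) (star ρ τ u v) _ _)
              (trans (cong₂ _+_ (split-red u v) (star-split u v)) (reassemble u v)))
            (withStar-irregular ρ τ (red g) (red-sym g) red-centre (proj₁ τρ) (λ v _ → red-ok v)
              λ u v u≢ρ v≢ρ pos → safe-red S g g-bounded compatible τ τ′ τ-even τ′-even off {u} {v}
                (safe u v u≢ρ v≢ρ pos (split-red u v)) pos)
            (withStar-irregular ρ τ′ (red (complement g)) (red-sym (complement g)) blue-centre
              (proj₂ τρ) (λ v _ → blue-ok v)
              λ u v u≢ρ v≢ρ pos → safe-blue S g g-bounded compatible τ τ′ τ-even τ′-even off {u} {v}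
                (safe u v u≢ρ v≢ρ pos (trans (ℕ.+-comm _ (red g u v)) (split-red u v))) pos)

        assemble : LocallyIrregularColorableWith 2 (² G)
        assemble = with-star (starColouring
          (λ v pos → subst (0 <_) (sym (Red+Blue g-bounded v)) (full-positive v pos)) neighbours)

    even-colorable : LocallyIrregularColorableWith 2 (² G)
    even-colorable = from-parities (even-alternating S μ μ-odd)
      where
      from-parities : ∃[ p ] ((∀ v → Alternating p v) × parity (sum (λ v → μ v * bit (p v))) ≡ 0ℙ) →
                      LocallyIrregularColorableWith 2 (² G)
      from-parities (p , alt , even-sum) = assemble p alt even-sum (solve p)

-- Search trees of a cactus in the odd and in the even case.

module _ {G : Graph n} {root : Fin n} (tree : DFSTree G root) (cactus : IsCactus G) where
  open Graph G
  open DFSTree tree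
  open TreeProperties G tree

  module _ (adj′ : Fin n → Fin n → Bool)
    (adj′-sym : ∀ u v → adj′ u v ≡ adj′ v u)
    (sub : ∀ {u v} → adj′ u v ≡ true → Adj u v)
    (isolated : ∀ {v x} → Parent v x → adj′ v x ≡ false → ∀ {y} → y ∈ anc v → adj′ v y ≡ false)
    where
    open Sub cactus adj′ adj′-sym sub isolated

    skeleton-spans : Spans skeleton adj′
    skeleton-spans = record
      { edges = λ {u} {v} uv → case normal u v (sub uv) of λ where
          (inj₁ u∈) → inj₂ (upward (trans (adj′-sym v u) uv) refl (up-spec v) u∈)
          (inj₂ v∈) → inj₁ (upward uv refl (up-spec u) v∈)
      ; red-full = red-full }
      where
      upward : ∀ {u v U} → adj′ u v ≡ true → up u ≡ U → Upper u U → v ∈ anc u →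
               up u ≡ one v ⊎ (∃[ w ] up u ≡ two v w) ⊎ (∃[ x ] up u ≡ two x v)
      upward uv _ (none ∄) v∈ = case trans (sym uv) (∄ v∈) of λ ()
      upward uv e (one ux _ ∄) v∈ = case subst (_ ∈_) ux v∈ of λ where
        (here refl) → inj₁ e
        (there v∈x) → case trans (sym uv) (∄ v∈x) of λ ()
      upward uv e s@(two {x} {w} ux adj _ _) v∈ = case subst (_ ∈_) ux v∈ of λ where
        (here refl) → inj₂ (inj₁ (w , e))
        (there v∈x) → inj₂ (inj₂ (x , trans e
          (cong (two x) (unique-back cactus (backEdge s) (backEdge (two ux adj v∈x uv))))))

  isTrue : ∀ {b} → T b → b ≡ true
  isTrue = Equivalence.to T-≡

  module _ (odd : parity n ≡ 1ℙ) where
    private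
      isolated : ∀ {v x} → Parent v x → adj v x ≡ false → ∀ {y} → y ∈ anc v → adj v y ≡ false
      isolated vx eq _ = case trans (sym eq) (isTrue (proj₂ (unfold vx))) of λ ()

    open Sub cactus adj symmetric (Equivalence.from T-≡) isolated

    odd-order : LocallyIrregularColorableWith 2 (² G)
    odd-order = odd-colorable G skeleton
      (skeleton-spans adj symmetric (Equivalence.from T-≡) isolated) only-root odd
      where
      only-root : ∀ {v} → up v ≡ none → v ≡ root
      only-root {v} e = case subst (Upper v) e (up-spec v) of λ { (none ∄) → case shape v of λ where
        (inj₁ v≡root) → v≡root
        (inj₂ (x , vx , adj-vx)) → case trans (sym (∄ (parent∈ vx))) (isTrue adj-vx) of λ () }

  private
    mult : Fin n → Fin n → ℕ
    mult = Multigraph.mult (² G)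

    mult-adj : ∀ {u v} → Adj u v → mult u v ≡ 2
    mult-adj uv = cong (if_then 2 else 0) (isTrue uv)

    mult-nonadj : ∀ {u v} → ¬ Adj u v → mult u v ≡ 0
    mult-nonadj {u} {v} ¬uv with adj u v
    ... | true = contradiction _ ¬uv
    ... | false = refl

  module Deepest (z : Fin n) (deepest : ∀ v → depth v ≤ depth z) where
    open import Data.List.Membership.DecPropositional (_≟_ {n}) using (_∈?_)

    leaf : ∀ {v} → ¬ z ∈ anc v
    leaf {v} z∈ = ℕ.<⇒≱ (anc-depth z∈) (deepest v)

    private
      -- A deepest vertex has no descendants, so its neighbours are its parent and, by
      -- `unique-back`, at most one further ancestor.
      neighbours-by : ∀ {x} → Parent z x → OneOrTwo (mult z)
      neighbours-by {x} zx = by-search (any? (λ w → (w ∈? anc x) ×-dec T? (adj z w)))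
        where
        Adj-zx : Adj z x
        Adj-zx = proj₂ (unfold zx)

        neighbour : ∀ {v} → Adj z v → v ≢ x → v ∈ anc x
        neighbour {v} zv v≢x = case normal z v zv of λ where
          (inj₁ z∈) → contradiction z∈ leaf
          (inj₂ v∈) → case subst (v ∈_) zx v∈ of λ where
            (here v≡x) → contradiction v≡x v≢x
            (there v∈x) → v∈x

        by-search : Dec (∃[ w ] (w ∈ anc x × Adj z w)) → OneOrTwo (mult z)
        by-search (no ∄w) = inj₁ (x , formula)
          where
          formula : ∀ v → mult z v ≡ single x v 2
          formula v with x ≟ v
          ... | yes refl = mult-adj Adj-zx
          ... | no x≢v = mult-nonadj λ zv → ∄w (v , neighbour zv (≢-sym x≢v) , zv)
        by-search (yes (w , w∈ , zw)) = inj₂ (x , w , ≢-sym (anc⇒≢ w∈) , formula)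
          where
          formula : ∀ v → mult z v ≡ single x v 2 + single w v 2
          formula v with x ≟ v | w ≟ v
          ... | yes refl | yes refl = contradiction refl (anc⇒≢ w∈)
          ... | yes refl | no _ = mult-adj Adj-zx
          ... | no _ | yes refl = mult-adj zw
          ... | no x≢v | no w≢v = mult-nonadj λ zv → w≢v (unique-back cactus
            record { parent = x ; isParent = zx ; ancestor = w∈ ; back = zw }
            record { parent = x ; isParent = zx ; ancestor = neighbour zv (≢-sym x≢v) ; back = zv })

    neighbours : z ≢ root → OneOrTwo (mult z)
    neighbours z≢root with shape z
    ... | inj₁ z≡root = contradiction z≡root z≢root
    ... | inj₂ (x , zx , _) = neighbours-by zx

    Adj⁻ : Fin n → Fin n → Set
    Adj⁻ u v = removeVertex G z u v ≡ true

    Adj⁻-sym : ∀ u v → Adj⁻ u v → Adj⁻ v u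
    Adj⁻-sym u v = trans (removeVertex-sym G z v u)

    private
      to-root : ∀ xs {v} → anc v ≡ xs → v ≢ z → Star Adj⁻ v root
      to-root xs {v} eq v≢z with shape v
      ... | inj₁ refl = ε
      to-root [] eq v≢z | inj₂ (x , vx , _) = case trans (sym eq) vx of λ ()
      to-root (_ ∷ xs) {v} eq v≢z | inj₂ (x , vx , v~x) =
        trans (removeVertex-other G z v≢z x≢z) (isTrue v~x)
          ◅ to-root xs (sym (∷-injectiveʳ (trans (sym eq) vx))) x≢z
        where
        x≢z : x ≢ z
        x≢z refl = leaf (parent∈ vx)

    -- Tree paths to the root from other vertices never pass through the leaf `z`.
    connected : ∀ u v → u ≢ z → v ≢ z → Star Adj⁻ u v
    connected u v u≢z v≢z = to-root _ refl u≢z ◅◅ reverse (λ {u} {v} → Adj⁻-sym u v) (to-root _ refl v≢z)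

  module Rerooted
    (connected : ∀ u v → u ≢ root → v ≢ root → Star (λ u v → removeVertex G root u v ≡ true) u v)
    (neighbours : OneOrTwo (mult root))
    (another : ∀ {v} → v ≢ root → ∃[ y ] (y ≢ root × y ≢ v))
    (even : parity n ≡ 0ℙ) where

    private
      adj⁻ : Fin n → Fin n → Bool
      adj⁻ = removeVertex G root

      adj⁻-sym : ∀ u v → adj⁻ u v ≡ adj⁻ v u
      adj⁻-sym = removeVertex-sym G root

      sub : ∀ {u v} → adj⁻ u v ≡ true → Adj u v
      sub {u} {v} uv = Equivalence.from T-≡ (proj₂ (proj₂ (removeVertex-elim G root u v uv)))

      not-root : ∀ {v y} → y ∈ anc v → v ≢ root
      not-root y∈ refl = case subst (_ ∈_) anc-root y∈ of λ ()

      kept : ∀ {u v} → Adj u v → u ≢ root → v ≢ root → adj⁻ u v ≡ true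
      kept uv u≢ v≢ = trans (removeVertex-other G root u≢ v≢) (isTrue uv)

      parent-root : ∀ {v x} → Parent v x → adj⁻ v x ≡ false → x ≡ root
      parent-root {x = x} vx eq = decidable-stable (x ≟ root) λ x≢root →
        case trans (sym eq) (kept (proj₂ (unfold vx)) (not-root (parent∈ vx)) x≢root) of λ ()

      child-anc : ∀ {v y} → Parent v root → y ∈ anc v → y ≡ root
      child-anc v-root y∈ = case subst (_ ∈_) (trans v-root (cong (root ∷_) anc-root)) y∈ of λ where
        (here y≡root) → y≡root

      -- A tree edge disappears only if it ends at the root, and a child of the root has no other
      -- ancestor.
      isolated : ∀ {v x} → Parent v x → adj⁻ v x ≡ false → ∀ {y} → y ∈ anc v → adj⁻ v y ≡ false
      isolated {v} {x} vx eq {y} y∈ with refl ← parent-root vx eq =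
        trans (cong (adj⁻ v) (child-anc vx y∈)) eq

    open Sub cactus adj⁻ adj⁻-sym sub isolated

    private
      root-child : ∀ xs {v} → anc v ≡ xs → v ≢ root → ∃[ a ] Parent a root
      root-child xs {v} eq v≢root with shape v
      ... | inj₁ v≡root = contradiction v≡root v≢root
      root-child [] eq v≢root | inj₂ (x , vx , _) = case trans (sym eq) vx of λ ()
      root-child (_ ∷ xs) {v} eq v≢root | inj₂ (x , vx , _) with x ≟ root
      ... | yes refl = v , vx
      ... | no x≢root = root-child xs (sym (∷-injectiveʳ (trans (sym eq) vx))) x≢root

      -- Descendants of a child a of the root are joined only to one another and
      -- to the root.
      descend : ∀ {a u v} → Parent a root → Star (λ u v → adj⁻ u v ≡ true) u v →
                a ∈ u ∷ anc u → a ∈ v ∷ anc v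
      descend a-root ε a∈ = a∈
      descend {a} {u} a-root (_◅_ {j = y} uy path) a∈ = descend a-root path (step (normal u y (sub uy)))
        where
        step : u ∈ anc y ⊎ y ∈ anc u → a ∈ y ∷ anc y
        step (inj₁ u∈) = there (case a∈ of λ where
          (here refl) → u∈
          (there a∈u) → anc-trans a∈u u∈)
        step (inj₂ y∈) = case comparable a∈ (there y∈) of λ where
          (inj₁ a∈y) → a∈y
          (inj₂ (here refl)) → here refl
          (inj₂ (there y∈a)) → contradiction (child-anc a-root y∈a)
            (proj₁ (proj₂ (removeVertex-elim G root u y uy)))

      -- A path from `a` to `v` that avoids the root stays, by `descend`, among `a` and its
      -- descendants.
      only-child : ∀ {a v} → Parent a root → Parent v root → v ≡ a
      only-child {a} {v} a-root v-root =
        case descend a-root (connected a v (not-root (parent∈ a-root)) (not-root (parent∈ v-root))) (here refl) of λ where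
          (here a≡v) → sym a≡v
          (there a∈) → contradiction (child-anc v-root a∈) (not-root (parent∈ a-root))

      root∈ : ∀ {y} → adj root y ≡ true → root ∈ anc y
      root∈ {y} eq = case normal root y (Equivalence.from T-≡ eq) of λ where
        (inj₁ root∈y) → root∈y
        (inj₂ y∈) → case subst (y ∈_) anc-root y∈ of λ ()

      root-back : ∀ {u x} → Parent u x → x ≢ root → adj root u ≡ true → BackEdge u root
      root-back {u} {x} ux x≢root eq = record
        { parent = x ; isParent = ux
        ; ancestor = case subst (root ∈_) ux (root∈ eq) of λ where
            (here root≡x) → contradiction (sym root≡x) x≢root
            (there root∈x) → root∈x
        ; back = Adj-sym G (Equivalence.from T-≡ eq) }

      -- If the root were adjacent to `u`, then `u` would have two back edges. If it were adjacent
      -- to `x`, that edge would be a back edge, because `w` above `x` shows that the root is not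
      -- the parent of `x`; its fundamental cycle would then violate `separated-back`.
      away-spec : ∀ {u x w} → Upper u (two x w) → adj root u ≡ false × adj root x ≡ false
      away-spec {u} {x} {w} s@(two ux _ w∈ uw) =
        (¬-not λ eq → w≢root (unique-back cactus (backEdge s) (root-back ux (not-root w∈) eq))) ,
        (¬-not λ eq → case hasParent w∈ of λ (y , xy) →
          anc⇒≢ (parent∈ ux) (separated-back cactus (backEdge s)
            (root-back xy (λ { refl → w≢root (child-anc xy w∈) }) eq) (inj₂ (inj₂ refl))))
        where
        w≢root : w ≢ root
        w≢root = proj₁ (proj₂ (removeVertex-elim G root u w uw))

      -- A path to a third vertex that avoids the root leaves `v` along a surviving edge.
      nonisolated : ∀ {v} → adj root v ≡ true → ∃[ u ] adj⁻ v u ≡ true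
      nonisolated {v} eq = case another v≢root of λ (y , y≢root , y≢v) →
          first (connected v y v≢root y≢root) (≢-sym y≢v)
        where
        v≢root : v ≢ root
        v≢root refl = Adj-irrefl G (Equivalence.from T-≡ eq)
        first : ∀ {y} → Star (λ u v → adj⁻ u v ≡ true) v y → v ≢ y → ∃[ u ] adj⁻ v u ≡ true
        first ε v≢v = contradiction refl v≢v
        first (_◅_ {j = u} vu _) _ = u , vu

      only : ∀ {a} → Parent a root → ∀ {v} → up v ≡ none → v ≢ root → v ≡ a
      only {a} a-root {v} e v≢root = case subst (Upper v) e (up-spec v) of λ { (none ∄) → case shape v of λ where
        (inj₁ v≡root) → contradiction v≡root v≢root
        (inj₂ (x , vx , _)) →
          only-child a-root (subst (Parent v) (parent-root vx (∄ (parent∈ vx))) vx) }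

    even-order : ∀ {v} → v ≢ root → LocallyIrregularColorableWith 2 (² G)
    even-order v≢root = case root-child _ refl v≢root of λ (a , a-root) →
      even-colorable G skeleton root (skeleton-spans adj⁻ adj⁻-sym sub isolated) (only a-root)
        (λ {u} e → away-spec (subst (Upper u) e (up-spec u))) nonisolated neighbours even

-- Small orders, the choice of the search root, and the conclusion.

deepest-vertex : ∀ (depth : Fin n → ℕ) → Fin n → ∃[ z ] (∀ v → depth v ≤ depth z)
deepest-vertex {n} depth v₀ = argmax depth v₀ (allFin n) ,
  λ v → All.lookup (f[xs]≤f[argmax] v₀ (allFin n)) (∈-allFin v)

third : ∀ {m} {u v : Fin (3 + m)} → v ≢ u → ∃[ y ] (y ≢ u × y ≢ v)
third {u = u} {v} v≢u = punchIn u j , punchInᵢ≢i u j , λ eq →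
    punchInᵢ≢i i zero (punchIn-injective u j i (trans eq (sym (punchIn-punchOut (≢-sym v≢u)))))
  where
  i = punchOut (≢-sym v≢u)
  j = punchIn i zero

order-2 : (G : Graph 2) → Connected G → G ≅ complete 2
order-2 G (_ , paths) = record { bijection = ↔-refl ; preserves = same }
  where
  open Graph G
  edge : Star Adj zero (suc zero) → adj zero (suc zero) ≡ true
  edge (_◅_ {j = zero} loop _) = contradiction loop (Adj-irrefl G)
  edge (_◅_ {j = suc zero} step _) = Equivalence.to T-≡ step

  same : ∀ u v → adj u v ≡ Graph.adj (complete 2) u v
  same zero zero = loopless zero
  same zero (suc zero) = edge (paths zero (suc zero))
  same (suc zero) zero = trans (symmetric (suc zero) zero) (edge (paths zero (suc zero)))
  same (suc zero) (suc zero) = loopless (suc zero)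

two-colorable : ∀ n (G : Graph n) → Connected G → IsCactus G → ¬ (G ≅ complete 2) →
                LocallyIrregularColorableWith 2 (² G)
two-colorable n G (r , paths) cactus ≇K₂ = by-parity (parity n) refl
  where
  by-even : ∀ n (G : Graph n) → Connected G → IsCactus G → ¬ (G ≅ complete 2) → parity n ≡ 0ℙ →
            LocallyIrregularColorableWith 2 (² G)
  -- Order 0 is excluded by the vertex in `Connected` and order 1 by parity; order 2 leaves only the
  -- complete graph.
  by-even 2 G conn _ ≇K₂ _ = contradiction (order-2 G conn) ≇K₂
  by-even n@(suc (suc (suc m))) G (r , paths) cactus _ even = reroot (deepest-vertex depth r)
    where
    first : DFSTree G r
    first = Search.tree G r (paths r)
    open DFSTree first
    open TreeProperties G first using (depth; anc-depth; parent∈)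

    reroot : ∃[ z ] (∀ v → depth v ≤ depth z) → LocallyIrregularColorableWith 2 (² G)
    -- The first tree serves to find `z`; a second search starts at `z`, so that the vertex to be
    -- removed is the root.
    reroot (z , deepest) = Rerooted.even-order (Search.tree G z (paths z)) cactus
        Z.connected (Z.neighbours z≢r) third even {proj₁ distinct} (proj₂ distinct)
      where
      module Z = Deepest first cactus z deepest
      distinct : ∃[ y ] y ≢ z
      distinct = punchIn z zero , punchInᵢ≢i z zero

      z≢r : z ≢ r
      z≢r refl with shape (proj₁ distinct)
      ... | inj₁ y≡z = proj₂ distinct y≡z
      -- Were the root deepest, all depths would be 0, but this vertex has a parent.
      ... | inj₂ (x , yx , _) = ℕ.<⇒≱
        (ℕ.≤-<-trans z≤n (anc-depth (parent∈ yx)))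
        (ℕ.≤-trans (deepest _) (ℕ.≤-reflexive (cong length anc-root)))

  by-parity : ∀ q → parity n ≡ q → LocallyIrregularColorableWith 2 (² G)
  by-parity 0ℙ even = by-even n G (r , paths) cactus ≇K₂ even
  by-parity 1ℙ odd = odd-order (Search.tree G r (paths r)) cactus odd

theorem6 : ∀ (n : ℕ) (G : Graph n) →
    Connected G → IsCactus G → ¬ (G ≅ complete 2) →
    LocallyIrregularColorable (² G) × (∃[ k ] (Lir (² G) k × k ≤ 2))
theorem6 n G connected cactus ≇K₂ =
  let colorable = two-colorable n G connected cactus ≇K₂
  in (2 , colorable) , Lir-≤2 (² G) colorable
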